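{- Let $\mathbb{M}=\langle M,\mathcal{C}\rangle$ be a countable transitive model of $\mathsf{GB}^-$ and let $\mathbb{P}$ be a notion of class forcing for $\mathbb{M}$. If $\mathbb{P}$ satisfies the definability lemma either for "$v_0\in v_1$" or for "$v_0=v_1$" over $\mathbb{M}$, then $\mathbb{P}$ satisfies the forcing theorem over $\mathbb{M}$ for every $\mathcal{L}^n$-formula (for every $n<\omega$).
   Context: We work in a model $\mathsf{V}$ of $\mathsf{ZFC}$. $\mathsf{ZF}^-$ is $\mathsf{ZF}$ without power set and with Collection instead of Replacement. $\mathsf{GB}^-$ is the two-sorted theory (sets and classes) whose set axioms are those of $\mathsf{ZF}^-$ with class parameters allowed in Separation and Collection and whose class axioms are extensionality, foundation and first-order class comprehension (only set quantifiers). A countable transitive model of $\mathsf{GB}^-$ is a model $\mathbb{M}=\langle M,\mathcal{C}\rangle$ of $\mathsf{GB}^-$ (sets: $M$; classes: $\mathcal{C}\subseteq\mathcal{P}(M)$) such that $M$ is transitive and $M,\mathcal{C}$ are countable in $\mathsf{V}$. A notion of class forcing for $\mathbb{M}$ is a preorder $\mathbb{P}=\langle P,\leq_{\mathbb{P}}\rangle$ with $P,\leq_{\mathbb{P}}\in\mathcal{C}$. A $\mathbb{P}$-name is an object all of whose elements are of the form $\langle\tau,p\rangle$ with $\tau$ a $\mathbb{P}$-name and $p\in\mathbb{P}$; $M^{\mathbb{P}}$ (resp. $\mathcal{C}^{\mathbb{P}}$) is the set of $\mathbb{P}$-names in $M$ (resp. $\mathcal{C}$). A filter $G$ on $\mathbb{P}$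 is $\mathbb{P}$-generic over $\mathbb{M}$ if it meets every dense subset of $\mathbb{P}$ that is an element of $\mathcal{C}$. For such $G$ and $\sigma\in M^{\mathbb{P}}\cup\mathcal{C}^{\mathbb{P}}$ let $\sigma^G=\{\tau^G\mid\exists p\in G\ \langle\tau,p\rangle\in\sigma\}$, and $M[G]=\{\sigma^G\mid\sigma\in M^{\mathbb{P}}\}$. For $n<\omega$, $\mathcal{L}^n$ is the first-order language extending the language of set theory $\mathcal{L}_\in$ by unary predicate symbols $A_0,\ldots,A_{n-1}$ (so $\mathcal{L}^0=\mathcal{L}_\in$). For an $\mathcal{L}^n$-formula $\varphi(v_0,\ldots,v_{m-1})$, $\vec{\Gamma}=\langle\Gamma_0,\ldots,\Gamma_{n-1}\rangle\in(\mathcal{C}^{\mathbb{P}})^n$, $p\in P$ and $\sigma_0,\ldots,\sigma_{m-1}\in M^{\mathbb{P}}$, write $p\Vdash^{\mathbb{M},\vec\Gamma}_{\mathbb{P}}\varphi(\sigma_0,\ldots,\sigma_{m-1})$ if $\varphi(\sigma_0^G,\ldots,\sigma_{m-1}^G)$ holds in $M_{\vec\Gamma}[G]=\langle M[G],\in,\Gamma_0^G,\ldots,\Gamma_{n-1}^G\rangle$ whenever $G$ is $\mathbb{P}$-generic over $\mathbb{M}$ with $p\in G$. $\mathbb{P}$ satisfies the definability lemma for $\varphi$ over $\mathbb{M}$ if $\{\langle p,\sigma_0,\ldots,\sigma_{m-1}\rangle\in P\times M^{\mathbb{P}}\times\cdots\times M^{\mathbb{P}}\mid p\Vdash^{\mathbb{M},\vec\Gamma}_{\mathbb{P}}\varphi(\sigma_0,\ldots,\sigma_{m-1})\}\in\mathcal{C}$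 for all $\vec\Gamma\in(\mathcal{C}^{\mathbb{P}})^n$. It satisfies the truth lemma for $\varphi$ over $\mathbb{M}$ if for all $\sigma_0,\ldots,\sigma_{m-1}\in M^{\mathbb{P}}$, $\vec\Gamma\in(\mathcal{C}^{\mathbb{P}})^n$ and every $G$ that is $\mathbb{P}$-generic over $\mathbb{M}$ with $M_{\vec\Gamma}[G]\models\varphi(\sigma_0^G,\ldots,\sigma_{m-1}^G)$ there is $p\in G$ with $p\Vdash^{\mathbb{M},\vec\Gamma}_{\mathbb{P}}\varphi(\sigma_0,\ldots,\sigma_{m-1})$. It satisfies the forcing theorem for $\varphi$ over $\mathbb{M}$ if it satisfies both. -}

module Defs where

open import Data.Bool.Base using (Bool; true; false; if_then_else_)
open import Data.Nat.Base using (ℕ; suc)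
open import Data.Fin.Base using (Fin; zero; suc)
open import Data.Product using (Σ; ∃₂; ∃-syntax; _×_; _,_)
open import Data.Sum.Base using (_⊎_)
open import Data.Vec.Base using (Vec; []; _∷_; lookup; map)
open import Data.Vec.Relation.Unary.All using (All)
open import Function.Bundles using (_⇔_; mk⇔; Equivalence)
open import Relation.Nullary using (¬_)

------------------------------------------------------------------------
-- The universe of sets
--
-- The background universe is Aczel's type of iterative sets, with
-- extensional equality _≈_.  It is a classical universe of sets only in the
-- presence of excluded middle, which the theorem takes as a hypothesis.

data V : Set₁ where
  sup : (I : Set) → (I → V) → V

Idx : V → Set
Idx (sup I f) = I

elem : (x : V) → Idx x → V
elem (sup I f) = f

infix 4 _≈_ _∈_ _⊆_

_≈_ : V → V → Set
sup I f ≈ sup J g = (∀ i → ∃[ j ] f i ≈ g j) × (∀ j → ∃[ i ] f i ≈ g j)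

_∈_ : V → V → Set
x ∈ y = ∃[ j ] x ≈ elem y j

_⊆_ : V → V → Set₁
x ⊆ y = ∀ z → z ∈ x → z ∈ y

｛_,_｝ : V → V → V
｛ x , y ｝ = sup Bool (λ b → if b then x else y)

-- Kuratowski pairs.
⟪_,_⟫ : V → V → V
⟪ x , y ⟫ = ｛ ｛ x , x ｝ , ｛ x , y ｝ ｝

-- ⟨p,σ₀,σ₁,…⟩ = ⟨…⟨⟨p,σ₀⟩,σ₁⟩…⟩; the one-tuple ⟨p⟩ is p.
tuple : ∀ {m} → V → Vec V m → V
tuple p []       = p
tuple p (σ ∷ σs) = tuple ⟪ p , σ ⟫ σs

-- At most countable: X ⊆ { f 0 , f 1 , … } for some sequence f.
Countable : V → Set₁
Countable X = Σ (ℕ → V) λ f → ∀ x → x ∈ X → ∃[ k ] x ≈ f k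

Transitive : V → Set₁
Transitive X = ∀ x y → y ∈ x → x ∈ X → y ∈ X

------------------------------------------------------------------------
-- 𝓛ⁿ-formulas with free variables among v₀ , … , v_{m-1}
--
-- Variables are de Bruijn indices: under ∀̇ the bound variable is v₀ and
-- the previous v_i becomes v_{i+1}.  The remaining connectives and ∃ are
-- the usual classical abbreviations.

infix 6 _∈̇_ _≐_

data Formula (n : ℕ) : ℕ → Set where
  _∈̇_ : ∀ {m} → Fin m → Fin m → Formula n m
  _≐_ : ∀ {m} → Fin m → Fin m → Formula n m
  A   : ∀ {m} → Fin n → Fin m → Formula n m
  ¬̇_  : ∀ {m} → Formula n m → Formula n m
  _∧̇_ : ∀ {m} → Formula n m → Formula n m → Formula n m
  ∀̇_  : ∀ {m} → Formula n (suc m) → Formula n m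

-- ⟨D,∈,Γ₀,…,Γ_{n-1}⟩ ⊨ φ [ρ]
_,_⊨_[_] : V → ∀ {n m} → Vec V n → Formula n m → Vec V m → Set
D , Γ ⊨ i ∈̇ j   [ ρ ] = lookup ρ i ∈ lookup ρ j
D , Γ ⊨ i ≐ j   [ ρ ] = lookup ρ i ≈ lookup ρ j
D , Γ ⊨ A k i   [ ρ ] = lookup ρ i ∈ lookup Γ k
D , Γ ⊨ ¬̇ φ     [ ρ ] = ¬ (D , Γ ⊨ φ [ ρ ])
D , Γ ⊨ φ ∧̇ ψ   [ ρ ] = (D , Γ ⊨ φ [ ρ ]) × (D , Γ ⊨ ψ [ ρ ])
D , Γ ⊨ ∀̇ φ     [ ρ ] = (i : Idx D) → D , Γ ⊨ φ [ elem D i ∷ ρ ]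

------------------------------------------------------------------------
-- Models of GB⁻
--
-- A formula with set quantifiers only and class parameters Γ₀,…,Γ_{n-1} is
-- the same thing as an 𝓛ⁿ-formula with A_k interpreted as Γ_k.  (Equations
-- between classes need no separate atoms, since class extensionality
-- reduces them to set quantification.)

record IsGB⁻Model (M 𝒞 : V) : Set₁ where
  field
    classes⊆M : ∀ X → X ∈ 𝒞 → X ⊆ M

    extensionality : ∀ x y → x ∈ M → y ∈ M →
      (∀ z → z ∈ M → z ∈ x ⇔ z ∈ y) → x ≈ y

    foundation : ∀ x → x ∈ M → (∃[ y ] y ∈ M × y ∈ x) →
      ∃[ y ] y ∈ M × y ∈ x × (∀ z → z ∈ M → z ∈ y → ¬ z ∈ x)

    pairing : ∀ x y → x ∈ M → y ∈ M →
      ∃[ a ] a ∈ M × (∀ z → z ∈ M → z ∈ a ⇔ (z ≈ x ⊎ z ≈ y))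

    union : ∀ x → x ∈ M →
      ∃[ u ] u ∈ M × (∀ z → z ∈ M → z ∈ u ⇔ (∃[ y ] y ∈ M × y ∈ x × z ∈ y))

    infinity : ∃[ w ] w ∈ M
      × (∃[ e ] e ∈ M × e ∈ w × (∀ z → z ∈ M → ¬ z ∈ e))
      × (∀ x → x ∈ M → x ∈ w →
           ∃[ s ] s ∈ M × s ∈ w × (∀ z → z ∈ M → z ∈ s ⇔ (z ∈ x ⊎ z ≈ x)))

    separation : ∀ {n m} (φ : Formula n (suc m)) (Γ : Vec V n) (ρ : Vec V m) →
      All (_∈ 𝒞) Γ → All (_∈ M) ρ → ∀ a → a ∈ M →
      ∃[ b ] b ∈ M × (∀ x → x ∈ M → x ∈ b ⇔ (x ∈ a × M , Γ ⊨ φ [ x ∷ ρ ]))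

    collection : ∀ {n m} (φ : Formula n (suc (suc m))) (Γ : Vec V n) (ρ : Vec V m) →
      All (_∈ 𝒞) Γ → All (_∈ M) ρ → ∀ a → a ∈ M →
      (∀ x → x ∈ M → x ∈ a → ∃[ y ] y ∈ M × M , Γ ⊨ φ [ x ∷ y ∷ ρ ]) →
      ∃[ b ] b ∈ M ×
        (∀ x → x ∈ M → x ∈ a → ∃[ y ] y ∈ M × y ∈ b × M , Γ ⊨ φ [ x ∷ y ∷ ρ ])

    class-extensionality : ∀ X Y → X ∈ 𝒞 → Y ∈ 𝒞 →
      (∀ z → z ∈ M → z ∈ X ⇔ z ∈ Y) → X ≈ Y

    class-foundation : ∀ X → X ∈ 𝒞 → (∃[ y ] y ∈ M × y ∈ X) →
      ∃[ y ] y ∈ M × y ∈ X × (∀ z → z ∈ M → z ∈ y → ¬ z ∈ X)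

    class-comprehension : ∀ {n m} (φ : Formula n (suc m)) (Γ : Vec V n) (ρ : Vec V m) →
      All (_∈ 𝒞) Γ → All (_∈ M) ρ →
      ∃[ X ] X ∈ 𝒞 × (∀ x → x ∈ M → x ∈ X ⇔ M , Γ ⊨ φ [ x ∷ ρ ])

record CountableTransitiveModel : Set₁ where
  field
    M 𝒞          : V
    isGB⁻Model   : IsGB⁻Model M 𝒞
    M-transitive : Transitive M
    M-countable  : Countable M
    𝒞-countable  : Countable 𝒞

record ClassForcing (𝕄 : CountableTransitiveModel) : Set₁ where
  open CountableTransitiveModel 𝕄
  field
    P ≤P  : V
    P∈𝒞   : P ∈ 𝒞
    ≤P∈𝒞  : ≤P ∈ 𝒞

  infix 4 _≤_
  _≤_ : V → V → Set
  p ≤ q = ⟪ p , q ⟫ ∈ ≤P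

  field
    ≤P⊆P×P  : ∀ x → x ∈ ≤P → ∃₂ λ p q → x ≈ ⟪ p , q ⟫ × p ∈ P × q ∈ P
    ≤-refl  : ∀ p → p ∈ P → p ≤ p
    ≤-trans : ∀ p q r → p ≤ q → q ≤ r → p ≤ r

------------------------------------------------------------------------
-- Names and their evaluation
--
-- If x ≈ ⟪ τ , p ⟫ then τ is, up to ≈, an element of an element of x.
-- Recursion on names therefore runs over elements of elements of elements,
-- which keeps it structural and all the index types small.  The recursion
-- equations in their usual form are IsName-spec and val-spec below.

Idx² : V → Set
Idx² x = Σ (Idx x) λ j → Idx (elem x j)

elem² : (x : V) → Idx² x → V
elem² x (j , k) = elem (elem x j) k

IsName  : (P x : V) → Set
IsName¹ : (P x : V) → Idx x → Set
IsName² : (P x : V) → Idx² x → Set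

IsName P (sup I f) = ∀ i → ∃[ t ]
  (∃[ l ] f i ≈ ⟪ elem² (f i) t , elem P l ⟫) × IsName² P (f i) t
IsName¹ P (sup K h) k       = IsName P (h k)
IsName² P (sup J g) (j , k) = IsName¹ P (g j) k

-- val G σ is σᴳ.
val  : (G x : V) → V
val¹ : (G x : V) → Idx x → V
val² : (G x : V) → Idx² x → V

val G (sup I f) = sup
  (Σ I λ i → Σ (Idx² (f i)) λ t → ∃[ l ] f i ≈ ⟪ elem² (f i) t , elem G l ⟫)
  (λ (i , t , _) → val² G (f i) t)
val¹ G (sup K h) k       = val G (h k)
val² G (sup J g) (j , k) = val¹ G (g j) k

------------------------------------------------------------------------
-- Forcing

module _ (𝕄 : CountableTransitiveModel) (ℙ : ClassForcing 𝕄) where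
  open CountableTransitiveModel 𝕄
  open ClassForcing ℙ

  SetName ClassName : V → Set
  SetName   σ = σ ∈ M × IsName P σ
  ClassName Γ = Γ ∈ 𝒞 × IsName P Γ

  record Filter (G : V) : Set₁ where
    field
      G⊆P       : G ⊆ P
      nonempty  : ∃[ p ] p ∈ G
      upward    : ∀ p q → p ∈ G → p ≤ q → q ∈ G
      directed  : ∀ p q → p ∈ G → q ∈ G → ∃[ r ] r ∈ G × r ≤ p × r ≤ q

  Dense : V → Set₁
  Dense D = D ⊆ P × (∀ p → p ∈ P → ∃[ q ] q ∈ D × q ≤ p)

  record Generic (G : V) : Set₁ where
    field
      filter : Filter G
      meets  : ∀ D → D ∈ 𝒞 → Dense D → ∃[ p ] p ∈ G × p ∈ D

  -- M[G]
  Ext : V → V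
  Ext G = sup (Σ (Idx M) λ i → IsName P (elem M i)) (λ (i , _) → val G (elem M i))

  -- M_Γ[G] ⊨ φ(σ₀ᴳ,…,σ_{m-1}ᴳ)
  HoldsIn : ∀ {n m} → V → Vec V n → Formula n m → Vec V m → Set
  HoldsIn G Γ φ σ = Ext G , map (val G) Γ ⊨ φ [ map (val G) σ ]

  Forces : ∀ {n m} → V → Vec V n → Formula n m → Vec V m → Set₁
  Forces p Γ φ σ = ∀ G → Generic G → p ∈ G → HoldsIn G Γ φ σ

  DefinabilityLemma : ∀ {n m} → Formula n m → Set₁
  DefinabilityLemma {n} {m} φ = (Γ : Vec V n) → All ClassName Γ →
    ∃[ D ] D ∈ 𝒞 × (∀ x → x ∈ D ⇔
      (∃₂ λ p (σ : Vec V m) →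
         x ≈ tuple p σ × p ∈ P × All SetName σ × Forces p Γ φ σ))

  TruthLemma : ∀ {n m} → Formula n m → Set₁
  TruthLemma {n} {m} φ = (σ : Vec V m) → All SetName σ →
    (Γ : Vec V n) → All ClassName Γ →
    ∀ G → Generic G → HoldsIn G Γ φ σ → ∃[ p ] p ∈ G × Forces p Γ φ σ

  ForcingTheorem : ∀ {n m} → Formula n m → Set₁
  ForcingTheorem φ = DefinabilityLemma φ × TruthLemma φ

v₀∈v₁ v₀≐v₁ : Formula 0 2
v₀∈v₁ = zero ∈̇ suc zero
v₀≐v₁ = zero ≐ suc zero

------------------------------------------------------------------------
-- The usual recursion equations for names and evaluations

≈-refl : ∀ {x} → x ≈ x
≈-refl {sup I f} = (λ i → i , ≈-refl) , (λ i → i , ≈-refl)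

≈-sym : ∀ {x y} → x ≈ y → y ≈ x
≈-sym {sup I f} {sup J g} (a , b) =
  (λ j → let i , e = b j in i , ≈-sym e) , (λ i → let j , e = a i in j , ≈-sym e)

≈-trans : ∀ {x y z} → x ≈ y → y ≈ z → x ≈ z
≈-trans {sup I f} {sup J g} {sup K h} (a , b) (c , d) =
  (λ i → let j , e = a i ; k , e′ = c j in k , ≈-trans e e′) ,
  (λ k → let j , e = d k ; i , e′ = b j in i , ≈-trans e′ e)

｛,｝-cong : ∀ {x x′ y y′} → x ≈ x′ → y ≈ y′ → ｛ x , y ｝ ≈ ｛ x′ , y′ ｝
｛,｝-cong p q =
  (λ { true → true , p ; false → false , q }) ,
  (λ { true → true , p ; false → false , q })

⟪,⟫-cong : ∀ {x x′ y y′} → x ≈ x′ → y ≈ y′ → ⟪ x , y ⟫ ≈ ⟪ x′ , y′ ⟫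
⟪,⟫-cong p q = ｛,｝-cong (｛,｝-cong p p) (｛,｝-cong p q)

≈-elem : ∀ {x y} → x ≈ y → (i : Idx x) → ∃[ j ] elem x i ≈ elem y j
≈-elem {sup I f} {sup J g} (a , b) = a

≈-elem² : ∀ {x y} → x ≈ y → (t : Idx² x) → ∃[ t′ ] elem² x t ≈ elem² y t′
≈-elem² e (j , k) =
  let j′ , e₁ = ≈-elem e j ; k′ , e₂ = ≈-elem e₁ k in (j′ , k′) , e₂

∈-respʳ : ∀ {x y z} → y ≈ z → x ∈ y → x ∈ z
∈-respʳ e (i , p) = let j , q = ≈-elem e i in j , ≈-trans p q

val²-elem² : ∀ G x t → val² G x t ≈ val G (elem² x t)
val²-elem² G (sup J g) (j , k) with g j
... | sup K h = ≈-refl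

IsName²-elem² : ∀ P x t → IsName² P x t ⇔ IsName P (elem² x t)
IsName²-elem² P (sup J g) (j , k) with g j
... | sup K h = mk⇔ (λ p → p) (λ p → p)

val-cong  : ∀ G {x y} → x ≈ y → val G x ≈ val G y
val²-cong : ∀ G x t {y} → elem² x t ≈ y → val² G x t ≈ val G y
val¹-cong : ∀ G x k {y} → elem x k ≈ y → val¹ G x k ≈ val G y

val¹-cong G (sup K h) k       e = val-cong G e
val²-cong G (sup J g) (j , k) e = val¹-cong G (g j) k e
val-cong G {sup I f} {sup J g} (a , b) =
  (λ { (i , t , l , p) →
     let j , e = a i
         t′ , e′ = ≈-elem² e t
     in (j , t′ , l , ≈-trans (≈-sym e) (≈-trans p (⟪,⟫-cong e′ ≈-refl))) ,
        ≈-trans (val²-cong G (f i) t e′) (≈-sym (val²-elem² G (g j) t′)) }) ,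
  (λ { (j , t′ , l , p) →
     let i , e = b j
         t , e′ = ≈-elem² (≈-sym e) t′
     in (i , t , l , ≈-trans e (≈-trans p (⟪,⟫-cong e′ ≈-refl))) ,
        ≈-trans (val²-cong G (f i) t (≈-sym e′)) (≈-sym (val²-elem² G (g j) t′)) })

IsName-cong  : ∀ P {x y} → x ≈ y → IsName P x → IsName P y
IsName²-cong : ∀ P x t {y} → elem² x t ≈ y → IsName² P x t → IsName P y
IsName¹-cong : ∀ P x k {y} → elem x k ≈ y → IsName¹ P x k → IsName P y

IsName¹-cong P (sup K h) k       e n = IsName-cong P e n
IsName²-cong P (sup J g) (j , k) e n = IsName¹-cong P (g j) k e n
IsName-cong P {sup I f} {sup J g} (a , b) n j =
  let i , e = b j
      t , (l , p) , q = n i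
      t′ , e′ = ≈-elem² e t
  in t′ , (l , ≈-trans (≈-sym e) (≈-trans p (⟪,⟫-cong e′ ≈-refl))) ,
     Equivalence.from (IsName²-elem² P (g j) t′) (IsName²-cong P (f i) t e′ q)

pair-elem² : ∀ {x τ p} → ⟪ τ , p ⟫ ≈ x → ∃[ t ] τ ≈ elem² x t
pair-elem² e = ≈-elem² e (true , true)

IsName-spec : ∀ {P σ} → IsName P σ ⇔
  (∀ x → x ∈ σ → ∃₂ λ τ p → x ≈ ⟪ τ , p ⟫ × IsName P τ × p ∈ P)
IsName-spec {P} {sup I f} = mk⇔
  (λ n x (i , e) →
     let t , (l , p) , q = n i
     in elem² (f i) t , elem P l , ≈-trans e p ,
        Equivalence.to (IsName²-elem² P (f i) t) q , l , ≈-refl)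
  (λ s i →
     let τ , p , e , n , l , e′ = s (f i) (i , ≈-refl)
         t , e″ = pair-elem² (≈-sym e)
     in t , (l , ≈-trans e (⟪,⟫-cong e″ e′)) ,
        Equivalence.from (IsName²-elem² P (f i) t) (IsName-cong P e″ n))

val-spec : ∀ {G σ x} → x ∈ val G σ ⇔
  (∃₂ λ τ p → p ∈ G × ⟪ τ , p ⟫ ∈ σ × x ≈ val G τ)
val-spec {G} {sup I f} = mk⇔
  (λ { ((i , t , l , p) , e) →
     elem² (f i) t , elem G l , (l , ≈-refl) , (i , ≈-sym p) ,
     ≈-trans e (val²-elem² G (f i) t) })
  (λ { (τ , p , (l , e₁) , (i , e₂) , e₃) →
     let t , e = pair-elem² e₂
     in (i , t , l , ≈-trans (≈-sym e₂) (⟪,⟫-cong e e₁)) ,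
        ≈-trans e₃ (≈-trans (val-cong G e) (≈-sym (val²-elem² G (f i) t))) })

Ext-spec : ∀ {𝕄} (ℙ : ClassForcing 𝕄) {G x} → x ∈ Ext 𝕄 ℙ G ⇔
  (∃[ σ ] SetName 𝕄 ℙ σ × x ≈ val G σ)
Ext-spec {𝕄} ℙ {G} = mk⇔
  (λ { ((i , n) , e) → elem M i , ((i , ≈-refl) , n) , e })
  (λ { (σ , ((i , e) , n) , e′) → (i , IsName-cong P e n) , ≈-trans e′ (val-cong G e) })
  where
  open CountableTransitiveModel 𝕄
  open ClassForcing ℙ

{-# OPTIONS --safe #-}
module Submission where

-- If 𝔸 is a definable class of conditions, the conditions in 𝔸 together with those having no
-- extension in 𝔸 form a dense class in 𝒞, so every generic filter G contains a condition of one
-- of the two kinds.  Together with definability of forced equality this gives the truth lemma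
-- for σ = τ by ∈-induction on σ: G contains either a condition putting some element of σ into
-- σᴳ while no extension witnesses it in τ, which by induction refutes σᴳ ⊆ τᴳ, or a condition
-- below which this never happens, and such a condition forces σ ⊆ τ.  Then p forces σ ∈ τ iff
-- densely many q ≤ p lie below some s with ⟨ρ,s⟩ ∈ τ and force σ = ρ, also for a class τ, and
-- the connectives follow by induction on formulas.
-- If membership is definable instead, p forces σ ⊆ τ iff q forces π ∈ τ whenever ⟨π,r⟩ ∈ σ and
-- q ≤ p , r; hence equality is definable as well.

open import Defs
open import Level using (Level; 0ℓ; _⊔_; Lift; lift; lower) renaming (suc to lsuc)
open import Axiom.ExcludedMiddle using (ExcludedMiddle)
open import Data.Bool.Base using (true; false)
open import Data.Empty using (⊥-elim)
open import Data.Fin.Base as Fin using (Fin; zero; suc; _↑ˡ_; _↑ʳ_)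
open import Data.Nat.Base using (ℕ; zero; suc; _+_)
open import Data.Nat.Properties using (+-comm)
open import Data.Product using (Σ; ∃₂; ∃-syntax; _×_; _,_; proj₁; proj₂)
open import Data.Sum.Base as Sum using (_⊎_; inj₁; inj₂; [_,_]′)
open import Data.Vec.Base using (Vec; []; _∷_; _++_; head; tail; lookup; map)
open import Data.Vec.Properties using (lookup-map; lookup-++ˡ; lookup-++ʳ)
open import Data.Vec.Relation.Binary.Pointwise.Inductive as Pointwise using (Pointwise; []; _∷_)
open import Data.Vec.Relation.Unary.All as All using (All; []; _∷_)
open import Data.Vec.Relation.Unary.All.Properties using (++⁺; lookup⁺; lookup⁻)
open import Function.Base using (_∘_)
open import Function.Bundles using (_⇔_; mk⇔; Equivalence)
open import Induction.WellFounded as WF using (WellFounded; Acc; acc)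
open import Relation.Binary.Construct.Closure.Transitive as TC using (TransClosure; [_]; _∷_)
open import Relation.Binary.PropositionalEquality.Core as ≡ using (_≡_; refl; subst₂)
open import Relation.Nullary using (yes; no; ¬_)
open import Relation.Nullary.Decidable using (map′; decidable-stable)

open Equivalence using (to; from)

-- Sets

∈-respˡ : ∀ {x y} z → x ≈ y → x ∈ z → y ∈ z
∈-respˡ z e (i , p) = i , ≈-trans (≈-sym e) p

≈-ext : ∀ {x y} → (∀ z → z ∈ x ⇔ z ∈ y) → x ≈ y
≈-ext {sup I f} {sup J g} h =
  (λ i → to (h (f i)) (i , ≈-refl)) ,
  (λ j → let i , e = from (h (g j)) (j , ≈-refl) in i , ≈-sym e)

∈-upair : ∀ {x y z} → z ∈ ｛ x , y ｝ ⇔ (z ≈ x ⊎ z ≈ y)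
∈-upair = mk⇔
  (λ { (true , e) → inj₁ e ; (false , e) → inj₂ e })
  (λ { (inj₁ e) → true , e ; (inj₂ e) → false , e })

⟪,⟫-injective : ∀ {a b c d} → ⟪ a , b ⟫ ≈ ⟪ c , d ⟫ → a ≈ c × b ≈ d
⟪,⟫-injective {a} {b} {c} {d} (l , r) = a≈c , b≈d (l false) (r false)
  where
  ∈-singleton : ∀ {x y z} → x ∈ z → z ≈ ｛ y , y ｝ → x ≈ y
  ∈-singleton x∈z e = Sum.reduce (to ∈-upair (∈-respʳ e x∈z))

  fst∈ : ∀ {x y} → x ∈ ｛ x , y ｝
  fst∈ = true , ≈-refl

  snd∈ : ∀ {x y} → y ∈ ｛ x , y ｝
  snd∈ = false , ≈-refl

  a≈c : a ≈ c
  a≈c with l true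
  ... | true  , e = ∈-singleton fst∈ e
  ... | false , e = ≈-sym (∈-singleton fst∈ (≈-sym e))

  -- If `｛ a , b ｝` is matched with the singleton `｛ c , c ｝`, then `b`, `c` and `a` coincide and
  -- `d` is traced back through its own match. Otherwise `｛ a , b ｝ ≈ ｛ c , d ｝`, and each of `b`
  -- and `d` is located in the other pair.
  b≈d : ∃[ j ] ｛ a , b ｝ ≈ elem ⟪ c , d ⟫ j →
        ∃[ i ] elem ⟪ a , b ⟫ i ≈ ｛ c , d ｝ → b ≈ d
  b≈d (true , e) (true , e′) =
    ≈-trans (∈-singleton snd∈ e)
            (≈-trans (≈-sym a≈c) (≈-sym (∈-singleton snd∈ (≈-sym e′))))
  b≈d (true , e) (false , e′) with to ∈-upair (∈-respʳ (≈-sym e′) snd∈)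
  ... | inj₁ d≈a = ≈-trans (∈-singleton snd∈ e) (≈-trans (≈-sym a≈c) (≈-sym d≈a))
  ... | inj₂ d≈b = ≈-sym d≈b
  b≈d (false , e) _ with to ∈-upair (∈-respʳ e snd∈) | to ∈-upair (∈-respʳ (≈-sym e) snd∈)
  ... | inj₂ b≈d′ | _        = b≈d′
  ... | inj₁ b≈c  | inj₁ d≈a = ≈-trans b≈c (≈-trans (≈-sym a≈c) (≈-sym d≈a))
  ... | inj₁ b≈c  | inj₂ d≈b = ≈-sym d≈b

∈-wellFounded : WellFounded _∈_
∈-wellFounded x = accessible x ≈-refl
  where
  -- A member of a set equals one of its subtrees only up to `≈`, so the structural recursion on `x`
  -- must cover every `y ≈ x`.
  accessible : ∀ x {y} → y ≈ x → Acc _∈_ y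
  accessible (sup I f) e = acc λ z∈y →
    let i , e′ = ∈-respʳ e z∈y in accessible (f i) e′

-- The names inside a name lie three memberships below it, so induction on names runs along the
-- transitive closure of `_∈_`.
∈-⟪,⟫⁺ : ∀ {x} y z → ⟪ x , y ⟫ ∈ z → TransClosure _∈_ x z
∈-⟪,⟫⁺ {x} y z xy∈z =
  _∷_ {y = ｛ x , x ｝} (true , ≈-refl) (_∷_ {y = ⟪ x , y ⟫} (true , ≈-refl) [ xy∈z ])

tuple-cong : ∀ {m x y} (σ : Vec V m) → x ≈ y → tuple x σ ≈ tuple y σ
tuple-cong []      e = e
tuple-cong (s ∷ σ) e = tuple-cong σ (⟪,⟫-cong e ≈-refl)

-- Formulas

⊨-cong : ∀ {D n m} {Γ : Vec V n} (φ : Formula n m) {ρ ρ′ : Vec V m} →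
  Pointwise _≈_ ρ ρ′ → D , Γ ⊨ φ [ ρ ] → D , Γ ⊨ φ [ ρ′ ]
⊨-cong (i ∈̇ j) {ρ} e h =
  ∈-respʳ (Pointwise.lookup e j) (∈-respˡ (lookup ρ j) (Pointwise.lookup e i) h)
⊨-cong (i ≐ j) e h =
  ≈-trans (≈-sym (Pointwise.lookup e i)) (≈-trans h (Pointwise.lookup e j))
⊨-cong {Γ = Γ} (A k i) e h = ∈-respˡ (lookup Γ k) (Pointwise.lookup e i) h
⊨-cong (¬̇ φ)   e h = λ h′ → h (⊨-cong φ (Pointwise.sym ≈-sym e) h′)
⊨-cong (φ ∧̇ ψ) e (h , h′) = ⊨-cong φ e h , ⊨-cong ψ e h′
⊨-cong (∀̇ φ)   e h = λ i → ⊨-cong φ (≈-refl ∷ e) (h i)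

-- Predicate symbols are renamed along with variables, because joining two formulas concatenates
-- their lists of class parameters.
rename : ∀ {n n′ m m′} → (Fin n → Fin n′) → (Fin m → Fin m′) → Formula n m → Formula n′ m′
rename g r (i ∈̇ j) = r i ∈̇ r j
rename g r (i ≐ j) = r i ≐ r j
rename g r (A k i) = A (g k) (r i)
rename g r (¬̇ φ)   = ¬̇ rename g r φ
rename g r (φ ∧̇ ψ) = rename g r φ ∧̇ rename g r ψ
rename g r (∀̇ φ)   = ∀̇ rename g (Fin.lift 1 r) φ

⊨-rename : ∀ {D n n′ m m′} {Γ : Vec V n} {Γ′ : Vec V n′} {ρ : Vec V m} {ρ′ : Vec V m′}
  {g : Fin n → Fin n′} {r : Fin m → Fin m′} (φ : Formula n m) →
  (∀ k → lookup Γ k ≡ lookup Γ′ (g k)) → (∀ i → lookup ρ i ≡ lookup ρ′ (r i)) →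
  D , Γ ⊨ φ [ ρ ] ⇔ D , Γ′ ⊨ rename g r φ [ ρ′ ]
⊨-rename (i ∈̇ j) eg er = mk⇔ (subst₂ _∈_ (er i) (er j))
                             (subst₂ _∈_ (≡.sym (er i)) (≡.sym (er j)))
⊨-rename (i ≐ j) eg er = mk⇔ (subst₂ _≈_ (er i) (er j))
                             (subst₂ _≈_ (≡.sym (er i)) (≡.sym (er j)))
⊨-rename (A k i) eg er = mk⇔ (subst₂ _∈_ (er i) (eg k))
                             (subst₂ _∈_ (≡.sym (er i)) (≡.sym (eg k)))
⊨-rename (¬̇ φ) eg er =
  let e = ⊨-rename φ eg er in mk⇔ (_∘ from e) (_∘ to e)
⊨-rename (φ ∧̇ ψ) eg er =
  let e = ⊨-rename φ eg er ; e′ = ⊨-rename ψ eg er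
  in mk⇔ (λ (a , b) → to e a , to e′ b) (λ (a , b) → from e a , from e′ b)
⊨-rename {D} {ρ = ρ} {ρ′} {r = r} (∀̇ φ) eg er =
  mk⇔ (λ h i → to (e i) (h i)) (λ h i → from (e i) (h i))
  where
  er′ : ∀ x i → lookup (x ∷ ρ) i ≡ lookup (x ∷ ρ′) (Fin.lift 1 r i)
  er′ x zero    = refl
  er′ x (suc i) = er i

  e = λ i → ⊨-rename φ eg (er′ (elem D i))

-- Predicates on sets definable over the model from class parameters

module Definability (em : ExcludedMiddle 0ℓ) (𝕄 : CountableTransitiveModel) where
  open CountableTransitiveModel 𝕄
  open IsGB⁻Model isGB⁻Model

  private variable
    ℓ ℓ′ : Level
    m k : ℕ
    R : Vec V m → Set ℓ
    S : Vec V m → Set ℓ′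

  -- The predicate may be large, as forcing is, since it quantifies over all generic filters; the
  -- formula is a small equivalent of it on `M`.
  record Definable {m ℓ} (R : Vec V m → Set ℓ) : Set (lsuc 0ℓ ⊔ ℓ) where
    field
      arity      : ℕ
      parameters : Vec V arity
      classes    : All (_∈ 𝒞) parameters
      formula    : Formula arity m
      correct    : ∀ ρ → All (_∈ M) ρ → R ρ ⇔ M , parameters ⊨ formula [ ρ ]

  open Definable

  respᵈ : (∀ ρ → All (_∈ M) ρ → R ρ ⇔ S ρ) → Definable R → Definable S
  respᵈ e d .arity      = d .arity
  respᵈ e d .parameters = d .parameters
  respᵈ e d .classes    = d .classes
  respᵈ e d .formula    = d .formula
  respᵈ e d .correct ρ ρ∈ = mk⇔ (to (d .correct ρ ρ∈) ∘ from (e ρ ρ∈))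
                                (to (e ρ ρ∈) ∘ from (d .correct ρ ρ∈))

  -- Giving `f` besides `r` lets the resulting predicate be stated with `head` and `tail` where
  -- lookups would not reduce.
  renameᵈ : {f : Vec V k → Vec V m} (r : Fin m → Fin k) →
    (∀ ρ i → lookup (f ρ) i ≡ lookup ρ (r i)) →
    Definable R → Definable (λ ρ → R (f ρ))
  renameᵈ r er d .arity      = d .arity
  renameᵈ r er d .parameters = d .parameters
  renameᵈ r er d .classes    = d .classes
  renameᵈ r er d .formula    = rename (λ k → k) r (d .formula)
  renameᵈ {f = f} r er d .correct ρ ρ∈ = mk⇔ (to e′ ∘ to e) (from e ∘ from e′)
    where
    fρ∈ : All (_∈ M) (f ρ)
    fρ∈ = lookup⁻ (λ i → ≡.subst (_∈ M) (≡.sym (er ρ i)) (lookup⁺ ρ∈ (r i)))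
    e  = d .correct (f ρ) fρ∈
    e′ = ⊨-rename (d .formula) (λ _ → refl) (er ρ)

  selectᵈ : (is : Vec (Fin k) m) → Definable R → Definable (λ ρ → R (map (lookup ρ) is))
  selectᵈ is = renameᵈ (lookup is) (λ ρ i → lookup-map i (lookup ρ) is)

  dropSecondᵈ : {R : Vec V (suc m) → Set ℓ} → Definable R →
    Definable (λ ρ → R (head ρ ∷ tail (tail ρ)))
  dropSecondᵈ = renameᵈ {f = λ ρ → head ρ ∷ tail (tail ρ)}
    (λ { zero → zero ; (suc i) → suc (suc i) })
    (λ { (_ ∷ _ ∷ _) zero → refl ; (_ ∷ _ ∷ _) (suc i) → refl })

  swapᵈ : {R : Vec V (suc (suc m)) → Set ℓ} → Definable R →
    Definable (λ ρ → R (head (tail ρ) ∷ head ρ ∷ tail (tail ρ)))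
  swapᵈ = renameᵈ {f = λ ρ → head (tail ρ) ∷ head ρ ∷ tail (tail ρ)}
    (λ { zero → suc zero ; (suc zero) → zero ; (suc (suc i)) → suc (suc i) })
    (λ { (_ ∷ _ ∷ _) zero → refl ; (_ ∷ _ ∷ _) (suc zero) → refl
       ; (_ ∷ _ ∷ _) (suc (suc i)) → refl })

  ∈ᵈ : (i j : Fin m) → Definable (λ ρ → lookup ρ i ∈ lookup ρ j)
  ∈ᵈ i j .arity        = 0
  ∈ᵈ i j .parameters   = []
  ∈ᵈ i j .classes      = []
  ∈ᵈ i j .formula      = i ∈̇ j
  ∈ᵈ i j .correct ρ ρ∈ = mk⇔ (λ h → h) (λ h → h)

  ≈ᵈ : (i j : Fin m) → Definable (λ ρ → lookup ρ i ≈ lookup ρ j)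
  ≈ᵈ i j .arity        = 0
  ≈ᵈ i j .parameters   = []
  ≈ᵈ i j .classes      = []
  ≈ᵈ i j .formula      = i ≐ j
  ≈ᵈ i j .correct ρ ρ∈ = mk⇔ (λ h → h) (λ h → h)

  ∈classᵈ : ∀ {X} → X ∈ 𝒞 → (i : Fin m) → Definable (λ ρ → lookup ρ i ∈ X)
  ∈classᵈ X∈𝒞 i .arity        = 1
  ∈classᵈ {X = X} X∈𝒞 i .parameters = X ∷ []
  ∈classᵈ X∈𝒞 i .classes      = X∈𝒞 ∷ []
  ∈classᵈ X∈𝒞 i .formula      = A zero i
  ∈classᵈ X∈𝒞 i .correct ρ ρ∈ = mk⇔ (λ h → h) (λ h → h)

  ¬ᵈ_ : Definable R → Definable (λ ρ → ¬ R ρ)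
  (¬ᵈ d) .arity      = d .arity
  (¬ᵈ d) .parameters = d .parameters
  (¬ᵈ d) .classes    = d .classes
  (¬ᵈ d) .formula    = ¬̇ d .formula
  (¬ᵈ d) .correct ρ ρ∈ = let e = d .correct ρ ρ∈ in mk⇔ (_∘ from e) (_∘ to e)

  infixr 6 _×ᵈ_
  infixr 5 _⊎ᵈ_
  infixr 4 _→ᵈ_

  _×ᵈ_ : Definable R → Definable S → Definable (λ ρ → R ρ × S ρ)
  (c ×ᵈ d) .arity      = c .arity + d .arity
  (c ×ᵈ d) .parameters = c .parameters ++ d .parameters
  (c ×ᵈ d) .classes    = ++⁺ (c .classes) (d .classes)
  (c ×ᵈ d) .formula    = rename (_↑ˡ d .arity) (λ i → i) (c .formula) ∧̇
                         rename (c .arity ↑ʳ_) (λ i → i) (d .formula)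
  (c ×ᵈ d) .correct ρ ρ∈ = mk⇔
    (λ (a , b) → to cˡ (to (c .correct ρ ρ∈) a) , to dʳ (to (d .correct ρ ρ∈) b))
    (λ (a , b) → from (c .correct ρ ρ∈) (from cˡ a) , from (d .correct ρ ρ∈) (from dʳ b))
    where
    Γ = c .parameters
    Δ = d .parameters
    cˡ = ⊨-rename (c .formula) (λ k → ≡.sym (lookup-++ˡ Γ Δ k)) (λ _ → refl)
    dʳ = ⊨-rename (d .formula) (λ k → ≡.sym (lookup-++ʳ Γ Δ k)) (λ _ → refl)

  -- Excluded middle is applied to the truth of the formula, which is small, and the result is
  -- carried over to `R`.
  stableᵈ : Definable R → ∀ {ρ} → All (_∈ M) ρ → ¬ ¬ R ρ → R ρ
  stableᵈ d ρ∈ ¬¬r =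
    let e = d .correct _ ρ∈
    in from e (decidable-stable em λ ¬s → ¬¬r (¬s ∘ to e))

  _→ᵈ_ : Definable R → Definable S → Definable (λ ρ → R ρ → S ρ)
  c →ᵈ d = respᵈ
    (λ ρ ρ∈ → mk⇔ (λ h r → stableᵈ d ρ∈ λ ¬s → h (r , ¬s)) (λ h (r , ¬s) → ¬s (h r)))
    (¬ᵈ (c ×ᵈ ¬ᵈ d))

  _⊎ᵈ_ : Definable R → Definable S → Definable (λ ρ → R ρ ⊎ S ρ)
  _⊎ᵈ_ {R = R} {S = S} c d = respᵈ (λ ρ ρ∈ → mk⇔ (classical ρ∈)
      [ (λ r (¬r , _) → ¬r r) , (λ s (_ , ¬s) → ¬s s) ]′)
    (¬ᵈ (¬ᵈ c ×ᵈ ¬ᵈ d))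
    where
    classical : ∀ {ρ} → All (_∈ M) ρ → ¬ (¬ R ρ × ¬ S ρ) → R ρ ⊎ S ρ
    classical {ρ} ρ∈ h with em {M , c .parameters ⊨ c .formula [ ρ ]}
    ... | yes p = inj₁ (from (c .correct ρ ρ∈) p)
    ... | no ¬p = inj₂ (stableᵈ d ρ∈ λ ¬s → h (¬p ∘ to (c .correct ρ ρ∈) , ¬s))

  ∀ᵈ : {R : Vec V (suc m) → Set ℓ} → Definable R → Definable (λ ρ → ∀ x → x ∈ M → R (x ∷ ρ))
  ∀ᵈ d .arity      = d .arity
  ∀ᵈ d .parameters = d .parameters
  ∀ᵈ d .classes    = d .classes
  ∀ᵈ d .formula    = ∀̇ d .formula
  ∀ᵈ d .correct ρ ρ∈ = mk⇔
    (λ h i → to (d .correct _ ((i , ≈-refl) ∷ ρ∈)) (h (elem M i) (i , ≈-refl)))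
    (λ h x (i , e) → from (d .correct _ ((i , e) ∷ ρ∈))
      (⊨-cong (d .formula) (≈-sym e ∷ Pointwise.refl ≈-refl) (h i)))

  ∃ᵈ : {R : Vec V (suc m) → Set ℓ} → Definable R →
    Definable (λ ρ → ∃[ x ] x ∈ M × R (x ∷ ρ))
  ∃ᵈ {R = R} d = respᵈ
    (λ ρ ρ∈ → mk⇔ (classical ρ∈) (λ (x , x∈ , r) h → h x x∈ r))
    (¬ᵈ ∀ᵈ (¬ᵈ d))
    where
    classical : ∀ {ρ} → All (_∈ M) ρ → ¬ (∀ x → x ∈ M → ¬ R (x ∷ ρ)) →
      ∃[ x ] x ∈ M × R (x ∷ ρ)
    classical {ρ} ρ∈ h with em {∃[ i ] M , d .parameters ⊨ d .formula [ elem M i ∷ ρ ]}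
    ... | yes (i , s) = elem M i , (i , ≈-refl) , from (d .correct _ ((i , ≈-refl) ∷ ρ∈)) s
    ... | no ¬s = ⊥-elim (h λ x (i , e) r → ¬s
      (i , ⊨-cong (d .formula) (e ∷ Pointwise.refl ≈-refl)
             (to (d .correct _ ((i , e) ∷ ρ∈)) r)))

  comprehension : {R : Vec V (suc m) → Set ℓ} {ρ : Vec V m} → Definable R → All (_∈ M) ρ →
    ∃[ X ] X ∈ 𝒞 × (∀ x → x ∈ X ⇔ (x ∈ M × R (x ∷ ρ)))
  comprehension {ρ = ρ} d ρ∈ =
    let X , X∈𝒞 , h = class-comprehension (d .formula) (d .parameters) ρ (d .classes) ρ∈
    in X , X∈𝒞 , λ x → mk⇔
      (λ x∈X → let x∈M = classes⊆M X X∈𝒞 x x∈X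
               in x∈M , from (d .correct _ (x∈M ∷ ρ∈)) (to (h x x∈M) x∈X))
      (λ (x∈M , r) → from (h x x∈M) (to (d .correct _ (x∈M ∷ ρ∈)) r))

  -- Truth of a formula is invariant under `≈`, and `R` inherits this on `M` through its formula.
  respects : Definable R → ∀ {ρ ρ′} → All (_∈ M) ρ → All (_∈ M) ρ′ →
    Pointwise _≈_ ρ ρ′ → R ρ → R ρ′
  respects d ρ∈ ρ′∈ e r =
    from (d .correct _ ρ′∈) (⊨-cong (d .formula) e (to (d .correct _ ρ∈) r))

  -- Pairs and tuples inside the model.

  upair∈M : ∀ {x y} → x ∈ M → y ∈ M → ｛ x , y ｝ ∈ M
  upair∈M {x} {y} x∈M y∈M =
    let a , a∈M , h = pairing x y x∈M y∈M
    -- Pairing describes `a` only by its members in `M`; transitivity of `M` makes these all of its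
    -- members.
    in ∈-respˡ M (≈-ext λ z → mk⇔
         (λ z∈a → from ∈-upair (to (h z (M-transitive a z z∈a a∈M)) z∈a))
         (λ z∈xy → from (h z (member x∈M y∈M (to ∈-upair z∈xy))) (to ∈-upair z∈xy))) a∈M
    where
    member : ∀ {x y z} → x ∈ M → y ∈ M → z ≈ x ⊎ z ≈ y → z ∈ M
    member x∈M y∈M (inj₁ e) = ∈-respˡ M (≈-sym e) x∈M
    member x∈M y∈M (inj₂ e) = ∈-respˡ M (≈-sym e) y∈M

  pair∈M : ∀ {x y} → x ∈ M → y ∈ M → ⟪ x , y ⟫ ∈ M
  pair∈M x∈M y∈M = upair∈M (upair∈M x∈M x∈M) (upair∈M x∈M y∈M)

  pair∈M⁻ : ∀ {x y} → ⟪ x , y ⟫ ∈ M → x ∈ M × y ∈ M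
  pair∈M⁻ {x} {y} xy∈M =
    let xy = M-transitive ⟪ x , y ⟫ ｛ x , y ｝ (false , ≈-refl) xy∈M
    in M-transitive ｛ x , y ｝ x (true , ≈-refl) xy , M-transitive ｛ x , y ｝ y (false , ≈-refl) xy

  tuple∈M : ∀ {x} (σ : Vec V m) → x ∈ M → All (_∈ M) σ → tuple x σ ∈ M
  tuple∈M []      x∈M []        = x∈M
  tuple∈M (s ∷ σ) x∈M (s∈ ∷ σ∈) = tuple∈M σ (pair∈M x∈M s∈) σ∈

  -- Set names thereby count as class names, so one argument serves for both.
  set⇒class : ∀ {x} → x ∈ M → x ∈ 𝒞
  set⇒class {x} x∈M =
    let X , X∈𝒞 , h = comprehension (∈ᵈ {2} zero (suc zero)) (x∈M ∷ [])
    in ∈-respˡ 𝒞 (≈-ext λ z → mk⇔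
         (λ z∈X → proj₂ (to (h z) z∈X))
         (λ z∈x → from (h z) (M-transitive x z z∈x x∈M , z∈x))) X∈𝒞

  upairᵈ : (i j k : Fin m) → Definable (λ ρ → lookup ρ i ≈ ｛ lookup ρ j , lookup ρ k ｝)
  upairᵈ i j k = respᵈ
    (λ ρ ρ∈ → mk⇔
      (λ h → ≈-ext λ z → mk⇔
        (λ z∈x → from ∈-upair (proj₁ (h z (M-transitive _ z z∈x (lookup⁺ ρ∈ i))) z∈x))
        (λ z∈yz → let z∈M = M-transitive _ z z∈yz (upair∈M (lookup⁺ ρ∈ j) (lookup⁺ ρ∈ k))
                  in proj₂ (h z z∈M) (to ∈-upair z∈yz)))
      (λ e z _ → (λ z∈x → to ∈-upair (∈-respʳ e z∈x)) ,
                 (λ h → ∈-respʳ (≈-sym e) (from ∈-upair h))))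
    (∀ᵈ ((∈ᵈ zero (suc i) →ᵈ z≈y⊎z≈y′) ×ᵈ (z≈y⊎z≈y′ →ᵈ ∈ᵈ zero (suc i))))
    where z≈y⊎z≈y′ = ≈ᵈ zero (suc j) ⊎ᵈ ≈ᵈ zero (suc k)

  pairᵈ : (i j k : Fin m) → Definable (λ ρ → lookup ρ i ≈ ⟪ lookup ρ j , lookup ρ k ⟫)
  pairᵈ i j k = respᵈ
    (λ ρ ρ∈ → mk⇔
      (λ (u , _ , v , _ , e , e′ , e″) → ≈-trans e″ (｛,｝-cong e e′))
      (λ e → let y∈ = lookup⁺ ρ∈ j ; z∈ = lookup⁺ ρ∈ k
             in _ , upair∈M y∈ y∈ , _ , upair∈M y∈ z∈ , ≈-refl , ≈-refl , e))
    (∃ᵈ (∃ᵈ (upairᵈ (suc zero) (suc (suc j)) (suc (suc j)) ×ᵈ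
             upairᵈ zero (suc (suc j)) (suc (suc k)) ×ᵈ
             upairᵈ (suc (suc i)) (suc zero) zero)))

  -- F is a class or a variable: no compound terms are needed as right-hand sides of ∈.
  record DefinableElements (F : Vec V m → V) : Set₁ where
    constructor elementsᵈ
    field elements : Definable (λ ρ → head ρ ∈ F (tail ρ))

  variableᵈ : (i : Fin m) → DefinableElements (λ ρ → lookup ρ i)
  variableᵈ i = elementsᵈ
    (respᵈ (λ { (x ∷ ρ) _ → mk⇔ (λ h → h) (λ h → h) }) (∈ᵈ zero (suc i)))

  constantᵈ : ∀ {X} → X ∈ 𝒞 → DefinableElements {m} (λ _ → X)
  constantᵈ X∈𝒞 = elementsᵈ
    (respᵈ (λ { (x ∷ ρ) _ → mk⇔ (λ h → h) (λ h → h) }) (∈classᵈ X∈𝒞 zero))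

  weakenᵈ : {F : Vec V m → V} → DefinableElements F → DefinableElements (λ ρ → F (tail ρ))
  weakenᵈ {F = F} (elementsᵈ d) = elementsᵈ (dropSecondᵈ {R = λ ρ → head ρ ∈ F (tail ρ)} d)

  pair∈ᵈ : {F : Vec V m → V} (i j : Fin m) → DefinableElements F →
    Definable (λ ρ → ⟪ lookup ρ i , lookup ρ j ⟫ ∈ F ρ)
  pair∈ᵈ {F = F} i j (elementsᵈ d) = respᵈ
    (λ ρ ρ∈ → mk⇔
      (λ (u , _ , e , h) → ∈-respˡ (F ρ) e h)
      (λ h → _ , pair∈M (lookup⁺ ρ∈ i) (lookup⁺ ρ∈ j) , ≈-refl , h))
    (∃ᵈ (pairᵈ zero (suc i) (suc j) ×ᵈ d))

  -- Tuples are nested to the left, so a predicate of `p , s , σ` becomes a predicate of `y , σ`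
  -- saying that `y` splits as `⟪ p , s ⟫`. Repeating this leaves a single variable.
  tuplesᵈ : ∀ m {R : Vec V (suc m) → Set ℓ} → Definable R →
    Definable {1} (λ ρ → ∃₂ λ p (σ : Vec V m) →
      All (_∈ M) (p ∷ σ) × head ρ ≈ tuple p σ × R (p ∷ σ))
  tuplesᵈ zero d = respᵈ
    (λ { (x ∷ []) (x∈ ∷ []) → mk⇔
      (λ r → x , [] , x∈ ∷ [] , ≈-refl , r)
      (λ { (p , [] , p∈ , e , r) → respects d p∈ (x∈ ∷ []) (≈-sym e ∷ []) r }) })
    d
  tuplesᵈ (suc m) {R} d = respᵈ
    (λ { (x ∷ []) _ → mk⇔
      (λ { (y , σ , _ ∷ σ∈ , e , p , p∈ , s , s∈ , e′ , r) →
        p , s ∷ σ , p∈ ∷ s∈ ∷ σ∈ , ≈-trans e (tuple-cong σ e′) , r })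
      (λ { (p , s ∷ σ , p∈ ∷ s∈ ∷ σ∈ , e , r) →
        ⟪ p , s ⟫ , σ , pair∈M p∈ s∈ ∷ σ∈ , e , p , p∈ , s , s∈ , ≈-refl , r }) })
    (tuplesᵈ m (∃ᵈ (∃ᵈ (pairᵈ (suc (suc zero)) (suc zero) zero ×ᵈ d′))))
    where
    -- The inner quantifier binds `s`, so the context begins with `s , p , y`; the order expected by
    -- `R` is `p , s` with `y` dropped.
    d′ = renameᵈ {f = λ ρ → lookup ρ (suc zero) ∷ lookup ρ zero ∷ tail (tail (tail ρ))}
      (λ { zero → suc zero ; (suc zero) → zero ; (suc (suc i)) → suc (suc (suc i)) })
      (λ { (_ ∷ _ ∷ _ ∷ ρ) zero → refl ; (_ ∷ _ ∷ _ ∷ ρ) (suc zero) → refl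
         ; (_ ∷ _ ∷ _ ∷ ρ) (suc (suc i)) → refl })
      d

-- Genericity and forcing

module Forcing (em₁ : ExcludedMiddle (lsuc 0ℓ))
               (𝕄 : CountableTransitiveModel) (ℙ : ClassForcing 𝕄) where
  open CountableTransitiveModel 𝕄
  open IsGB⁻Model isGB⁻Model using (classes⊆M)
  open ClassForcing ℙ
  open Definability (map′ lower lift em₁) 𝕄

  Name NameClass : V → Set
  Name      = SetName 𝕄 ℙ
  NameClass = ClassName 𝕄 ℙ

  GenericFilter : V → Set₁
  GenericFilter = Generic 𝕄 ℙ

  P⊆M : ∀ {p} → p ∈ P → p ∈ M
  P⊆M = classes⊆M P P∈𝒞 _

  ≤⇒∈P : ∀ {p q} → p ≤ q → p ∈ P × q ∈ P
  ≤⇒∈P p≤q =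
    let _ , _ , e , p∈P , q∈P = ≤P⊆P×P _ p≤q
        e₁ , e₂ = ⟪,⟫-injective e
    in ∈-respˡ P (≈-sym e₁) p∈P , ∈-respˡ P (≈-sym e₂) q∈P

  ≤⇒∈M : ∀ {p q} → p ≤ q → p ∈ M
  ≤⇒∈M p≤q = P⊆M (proj₁ (≤⇒∈P p≤q))

  ≤-respʳ : ∀ {p q r} → q ≈ r → p ≤ q → p ≤ r
  ≤-respʳ e = ∈-respˡ ≤P (⟪,⟫-cong ≈-refl e)

  module _ {G} (g : GenericFilter G) where
    open Filter (Generic.filter g)

    G⇒P : ∀ {p} → p ∈ G → p ∈ P
    G⇒P = G⊆P _

    G-up : ∀ {p q} → p ∈ G → p ≤ q → q ∈ G
    G-up = upward _ _

    common₂ : ∀ {p q} → p ∈ G → q ∈ G → ∃[ r ] r ∈ G × r ≤ p × r ≤ q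
    common₂ = directed _ _

    common₃ : ∀ {p q r} → p ∈ G → q ∈ G → r ∈ G →
      ∃[ s ] s ∈ G × s ≤ p × s ≤ q × s ≤ r
    common₃ p∈G q∈G r∈G =
      let t , t∈G , t≤p , t≤q = common₂ p∈G q∈G
          s , s∈G , s≤t , s≤r = common₂ t∈G r∈G
      in s , s∈G , ≤-trans _ _ _ s≤t t≤p , ≤-trans _ _ _ s≤t t≤q , s≤r

  Dense-cong : ∀ {D E} → D ≈ E → Dense 𝕄 ℙ D → Dense 𝕄 ℙ E
  Dense-cong e (D⊆P , dense) =
    (λ z z∈E → D⊆P z (∈-respʳ (≈-sym e) z∈E)) ,
    (λ p p∈P → let q , q∈D , q≤p = dense p p∈P in q , ∈-respʳ e q∈D , q≤p)

  -- Existence of generic filters and decision by genericity.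

  opaque
    -- The Rasiowa-Sikorski construction: a descending chain from `p` runs through an enumeration of
    -- `𝒞`, and `G` is its upward closure.
    generic-exists : ∀ {p} → p ∈ P → ∃[ G ] GenericFilter G × p ∈ G
    generic-exists {p} p∈P = G , generic , from ∈G⇔ (p∈P , 0 , ≤-refl p p∈P)
      where
      class : ℕ → V
      class = proj₁ 𝒞-countable

      descend : ∀ D q → q ∈ P → ∃[ r ] r ≤ q × (Dense 𝕄 ℙ D → r ∈ D)
      descend D q q∈P with em₁ {Dense 𝕄 ℙ D}
      ... | yes (_ , dense) = let r , r∈D , r≤q = dense q q∈P in r , r≤q , λ _ → r∈D
      -- A class that is not dense makes no demand, and the chain stands still.
      ... | no ¬dense       = q , ≤-refl q q∈P , λ dense → ⊥-elim (¬dense dense)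

      chain    : ℕ → V
      chain∈P  : ∀ k → chain k ∈ P
      chain-≤′ : ∀ k → chain (suc k) ≤ chain k

      chain zero    = p
      chain (suc k) = proj₁ (descend (class k) (chain k) (chain∈P k))

      chain∈P zero    = p∈P
      chain∈P (suc k) = proj₁ (≤⇒∈P (chain-≤′ k))

      chain-≤′ k = proj₁ (proj₂ (descend (class k) (chain k) (chain∈P k)))

      chain-≤ : ∀ j k → chain (j + k) ≤ chain k
      chain-≤ zero    k = ≤-refl _ (chain∈P k)
      chain-≤ (suc j) k = ≤-trans _ _ _ (chain-≤′ (j + k)) (chain-≤ j k)

      G : V
      G = sup (Σ (Idx P) λ i → ∃[ k ] chain k ≤ elem P i) (λ (i , _) → elem P i)

      ∈G⇔ : ∀ {x} → x ∈ G ⇔ (x ∈ P × ∃[ k ] chain k ≤ x)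
      ∈G⇔ = mk⇔
        (λ { ((i , k , h) , e) → (i , e) , k , ≤-respʳ (≈-sym e) h })
        (λ { ((i , e) , k , h) → (i , k , ≤-respʳ e h) , e })

      chain∈G : ∀ k → chain k ∈ G
      chain∈G k = from ∈G⇔ (chain∈P k , k , ≤-refl _ (chain∈P k))

      generic : GenericFilter G
      generic .Generic.filter = record
        { G⊆P      = λ x x∈G → proj₁ (to ∈G⇔ x∈G)
        ; nonempty = p , chain∈G 0
        ; upward   = λ p q p∈G p≤q → let _ , k , h = to ∈G⇔ p∈G in
            from ∈G⇔ (proj₂ (≤⇒∈P p≤q) , k , ≤-trans _ _ _ h p≤q)
        ; directed = λ p q p∈G q∈G →
            let _ , j , j≤p = to ∈G⇔ p∈G
                _ , k , k≤q = to ∈G⇔ q∈G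
            in chain (j + k) , chain∈G (j + k) ,
               ≤-trans _ _ _ (≡.subst (λ l → chain l ≤ chain j) (+-comm k j) (chain-≤ k j)) j≤p ,
               ≤-trans _ _ _ (chain-≤ j k) k≤q
        }
      generic .Generic.meets D D∈𝒞 dense =
        let k , e = proj₂ 𝒞-countable D D∈𝒞
            _ , _ , h = descend (class k) (chain k) (chain∈P k)
        -- The class numbered `k` is entered at stage `suc k`.
        in chain (suc k) , chain∈G (suc k) , ∈-respʳ (≈-sym e) (h (Dense-cong e dense))

  ≤ᵈ : ∀ {m} (i j : Fin m) → Definable (λ ρ → lookup ρ i ≤ lookup ρ j)
  ≤ᵈ i j = pair∈ᵈ i j (constantᵈ ≤P∈𝒞)

  opaque
    -- All later uses of the density requirement on `G` go through this lemma.
    generic-decides : ∀ {m} {R : Vec V (suc m) → Set₁} → Definable R →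
      ∀ {ρ} → All (_∈ M) ρ → ∀ {G} → GenericFilter G →
      (∃[ p ] p ∈ G × R (p ∷ ρ)) ⊎ (∃[ p ] p ∈ G × (∀ q → q ≤ p → ¬ R (q ∷ ρ)))
    generic-decides {R = R} d {ρ} ρ∈ {G} g =
      let D , D∈𝒞 , h = comprehension
            (∈classᵈ P∈𝒞 zero ×ᵈ (d ⊎ᵈ ∀ᵈ (≤ᵈ zero (suc zero) →ᵈ ¬ᵈ dropSecondᵈ d))) ρ∈
          p , p∈G , p∈D = Generic.meets g D D∈𝒞 (dense D h)
          _ , _ , decided = to (h p) p∈D
      in Sum.map (λ r → p , p∈G , r)
                 (λ ¬r → p , p∈G , λ q q≤p → ¬r q (≤⇒∈M q≤p) q≤p) decided
      where
      dense : ∀ D → (∀ p → p ∈ D ⇔ (p ∈ M × p ∈ P ×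
        (R (p ∷ ρ) ⊎ (∀ q → q ∈ M → q ≤ p → ¬ R (q ∷ ρ))))) → Dense 𝕄 ℙ D
      dense D h .proj₁ z z∈D = proj₁ (proj₂ (to (h z) z∈D))
      dense D h .proj₂ p p∈P with em₁ {∃[ q ] q ≤ p × R (q ∷ ρ)}
      ... | yes (q , q≤p , r) =
        q , from (h q) (≤⇒∈M q≤p , proj₁ (≤⇒∈P q≤p) , inj₁ r) , q≤p
      ... | no ¬r =
        p , from (h p) (P⊆M p∈P , p∈P , inj₂ λ q _ q≤p r → ¬r (q , q≤p , r)) , ≤-refl p p∈P

  -- Names and the forcing relation.

  Name-cong : ∀ {σ τ} → σ ≈ τ → Name σ → Name τ
  Name-cong e (σ∈M , n) = ∈-respˡ M e σ∈M , IsName-cong P e n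

  Name⇒NameClass : ∀ {σ} → Name σ → NameClass σ
  Name⇒NameClass (σ∈M , n) = set⇒class σ∈M , n

  NameClass-elements : ∀ Γ {π r} → NameClass Γ → ⟪ π , r ⟫ ∈ Γ → Name π × r ∈ P
  NameClass-elements Γ (Γ∈𝒞 , n) πr∈Γ =
    let _ , _ , e , n′ , p∈P = to (IsName-spec {P} {Γ}) n _ πr∈Γ
        e₁ , e₂ = ⟪,⟫-injective e
    in (proj₁ (pair∈M⁻ (classes⊆M Γ Γ∈𝒞 _ πr∈Γ)) , IsName-cong P (≈-sym e₁) n′) ,
       ∈-respˡ P (≈-sym e₂) p∈P

  val-∈ : ∀ G σ {π r} → r ∈ G → ⟪ π , r ⟫ ∈ σ → val G π ∈ val G σ
  val-∈ G σ {π} {r} r∈G πr∈σ = from (val-spec {G} {σ} {val G π}) (π , r , r∈G , πr∈σ , ≈-refl)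

  val-∈⁻ : ∀ G σ {x} → x ∈ val G σ → ∃₂ λ π r → r ∈ G × ⟪ π , r ⟫ ∈ σ × x ≈ val G π
  val-∈⁻ G σ = to (val-spec {G} {σ})

  Forced : ∀ {n m} → Vec V n → Formula n m → Vec V (suc m) → Set₁
  Forced Γ φ ρ = head ρ ∈ P × All Name (tail ρ) × Forces 𝕄 ℙ (head ρ) Γ φ (tail ρ)

  Forces-≤ : ∀ {n m p q} {Γ : Vec V n} {φ : Formula n m} {σ} →
    q ≤ p → Forces 𝕄 ℙ p Γ φ σ → Forces 𝕄 ℙ q Γ φ σ
  Forces-≤ q≤p f G g q∈G = f G g (G-up g q∈G q≤p)

  -- Membership of the triple in the given class returns a condition and names equal to the original
  -- ones only up to `≈`. Injectivity of pairs gives these equalities, and forcing is transported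
  -- along them.
  DefinabilityLemma⇒Forcedᵈ : (φ : Formula 0 2) → DefinabilityLemma 𝕄 ℙ φ →
    Definable (Forced [] φ)
  DefinabilityLemma⇒Forcedᵈ φ definability =
    let D , D∈𝒞 , h = definability [] []
    in respᵈ
      (λ { (p ∷ σ ∷ τ ∷ []) (p∈M ∷ σ∈M ∷ τ∈M ∷ []) → mk⇔
        (λ (u , _ , u≈pσ , uτ∈D) → let _ , _ , e , r = to (h _) uτ∈D in decode u≈pσ e r)
        (λ (p∈P , ns , f) →
          ⟪ p , σ ⟫ , pair∈M p∈M σ∈M , ≈-refl , from (h _) (p , _ , ≈-refl , p∈P , ns , f)) })
      (∃ᵈ (pairᵈ zero (suc zero) (suc (suc zero)) ×ᵈ
           pair∈ᵈ zero (suc (suc (suc zero))) (constantᵈ D∈𝒞)))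
    where
    decode : ∀ {u p σ τ p′ σs} → u ≈ ⟪ p , σ ⟫ → ⟪ u , τ ⟫ ≈ tuple p′ σs →
      p′ ∈ P × All Name σs × Forces 𝕄 ℙ p′ [] φ σs → Forced [] φ (p ∷ σ ∷ τ ∷ [])
    decode {σs = _ ∷ _ ∷ []} u≈pσ e (p′∈P , n ∷ n′ ∷ [] , f) =
      let u≈p′σ′ , τ≈ = ⟪,⟫-injective e
          p≈ , σ≈ = ⟪,⟫-injective (≈-trans (≈-sym u≈pσ) u≈p′σ′)
      in ∈-respˡ P (≈-sym p≈) p′∈P ,
         Name-cong (≈-sym σ≈) n ∷ Name-cong (≈-sym τ≈) n′ ∷ [] ,
         λ G g p∈G → ⊨-cong φ
           (≈-sym (val-cong G σ≈) ∷ ≈-sym (val-cong G τ≈) ∷ [])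
           (f G g (∈-respˡ G p≈ p∈G))

  -- From forced membership to forced equality.

  module FromMembership (memberᵈ : Definable (Forced [] v₀∈v₁)) where

    -- The hypothesis already contains the class of names, since p ⊩ σ ∈ {⟨σ,p⟩}; recursion on
    -- names inside 𝕄 is avoided.
    nameᵈ : Definable {2} (λ ρ → head ρ ∈ P × Name (lookup ρ (suc zero)))
    nameᵈ = respᵈ
      (λ { (p ∷ σ ∷ []) _ → mk⇔
        (λ { (_ , _ , p∈P , n ∷ _ , _) → p∈P , n })
        (λ (p∈P , n) →
          let x∈M = pair∈M (proj₁ n) (P⊆M p∈P) ; s∈M = upair∈M x∈M x∈M
          in _ , s∈M , p∈P , n ∷ (s∈M , singleton-IsName p∈P n) ∷ [] ,
             λ G g p∈G → val-∈ G ｛ ⟪ σ , p ⟫ , ⟪ σ , p ⟫ ｝ p∈G (true , ≈-refl)) })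
      (∃ᵈ (selectᵈ (suc zero ∷ suc (suc zero) ∷ zero ∷ []) memberᵈ))
      where
      singleton-IsName : ∀ {σ p} → p ∈ P → Name σ → IsName P ｛ ⟪ σ , p ⟫ , ⟪ σ , p ⟫ ｝
      singleton-IsName {σ} {p} p∈P (_ , n) = from IsName-spec λ x x∈ →
        σ , p , Sum.reduce (to ∈-upair x∈) , n , p∈P

    -- p ⊩ σ ⊆ τ, expressed by the forcing relation for ∈ alone.
    ForcedSubset : V → V → V → Set₁
    ForcedSubset p σ τ = ∀ π → π ∈ M → ∀ r → r ∈ M → ⟪ π , r ⟫ ∈ σ →
      ∀ q → q ∈ M → q ≤ p → q ≤ r → Forced [] v₀∈v₁ (q ∷ π ∷ τ ∷ [])

    subsetᵈ : ∀ {m} (i j k : Fin m) →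
      Definable (λ ρ → ForcedSubset (lookup ρ i) (lookup ρ j) (lookup ρ k))
    subsetᵈ i j k =
      ∀ᵈ (∀ᵈ (pair∈ᵈ (suc zero) zero (variableᵈ (suc (suc j))) →ᵈ
        ∀ᵈ (≤ᵈ zero (suc (suc (suc i))) →ᵈ ≤ᵈ zero (suc zero) →ᵈ
            selectᵈ (zero ∷ suc (suc zero) ∷ suc (suc (suc k)) ∷ []) memberᵈ)))

    subset-sound : ∀ {p σ τ} → Name σ → ForcedSubset p σ τ →
      ∀ {G} → GenericFilter G → p ∈ G → ∀ {x} → x ∈ val G σ → x ∈ val G τ
    subset-sound {σ = σ} {τ} n h {G} g p∈G x∈ =
      let π , r , r∈G , πr∈σ , e = val-∈⁻ G σ x∈
          q , q∈G , q≤p , q≤r = common₂ g p∈G r∈G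
          π∈M , r∈M = pair∈M⁻ (M-transitive σ _ πr∈σ (proj₁ n))
          _ , _ , f = h π π∈M r r∈M πr∈σ q (≤⇒∈M q≤p) q≤p q≤r
      in ∈-respˡ (val G τ) (≈-sym e) (f G g q∈G)

    -- A generic filter through `q` contains both `p` and `r`, so it puts the value of `π` into that
    -- of `σ`, which equals that of `τ`.
    subset-complete : ∀ {p σ τ} → Name σ → Name τ →
      (∀ G → GenericFilter G → p ∈ G → val G σ ≈ val G τ) → ForcedSubset p σ τ
    subset-complete {σ = σ} nσ nτ f π _ r _ πr∈σ q _ q≤p q≤r =
      proj₁ (≤⇒∈P q≤p) ,
      proj₁ (NameClass-elements σ (Name⇒NameClass nσ) πr∈σ) ∷ nτ ∷ [] ,
      λ G g q∈G → ∈-respʳ (f G g (G-up g q∈G q≤p))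
        (val-∈ G σ (G-up g q∈G q≤r) πr∈σ)

    equalᵈ : Definable (Forced [] v₀≐v₁)
    equalᵈ = respᵈ
      (λ { (p ∷ σ ∷ τ ∷ []) _ → mk⇔
        (λ ((p∈P , nσ) , (_ , nτ) , σ⊆τ , τ⊆σ) →
          p∈P , nσ ∷ nτ ∷ [] , λ G g p∈G → ≈-ext λ z →
            mk⇔ (subset-sound nσ σ⊆τ g p∈G) (subset-sound nτ τ⊆σ g p∈G))
        (λ { (p∈P , nσ ∷ nτ ∷ [] , f) →
          (p∈P , nσ) , (p∈P , nτ) , subset-complete nσ nτ f ,
          subset-complete nτ nσ (λ G g p∈G → ≈-sym (f G g p∈G)) }) })
      -- `ForcedSubset` can hold vacuously, so being a condition and being names are demanded
      -- separately.
      (selectᵈ (zero ∷ suc zero ∷ []) nameᵈ ×ᵈ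
       selectᵈ (zero ∷ suc (suc zero) ∷ []) nameᵈ ×ᵈ
       subsetᵈ zero (suc zero) (suc (suc zero)) ×ᵈ
       subsetᵈ zero (suc (suc zero)) (suc zero))

  -- The truth lemma for equality.

  module FromEquality (equalᵈ : Definable (Forced [] v₀≐v₁)) where

    ForcedEqual : V → V → V → Set₁
    ForcedEqual p σ τ = Forced [] v₀≐v₁ (p ∷ σ ∷ τ ∷ [])

    -- A condition forces `σ = σ` for every name `σ`, so the diagonal of the hypothesis is the class
    -- of names.
    nameᵈ : Definable {2} (λ ρ → head ρ ∈ P × Name (lookup ρ (suc zero)))
    nameᵈ = respᵈ
      (λ { (p ∷ σ ∷ []) _ → mk⇔
        (λ { (p∈P , n ∷ _ , _) → p∈P , n })
        (λ (p∈P , n) → p∈P , n ∷ n ∷ [] , λ _ _ _ → ≈-refl) })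
      (selectᵈ (zero ∷ suc zero ∷ suc zero ∷ []) equalᵈ)

    -- Some ⟨ρ,s⟩ ∈ τ with q ≤ s and q ⊩ π = ρ: the reason for q ⊩ π ∈ τ.
    Witnessed : V → V → V → Set₁
    Witnessed q π τ =
      ∃[ ρ ] ρ ∈ M × ∃[ s ] s ∈ M × ⟪ ρ , s ⟫ ∈ τ × q ≤ s × ForcedEqual q π ρ

    witnessedᵈ : ∀ {m} {F : Vec V m → V} (i j : Fin m) → DefinableElements F →
      Definable (λ ρ → Witnessed (lookup ρ i) (lookup ρ j) (F ρ))
    witnessedᵈ i j d =
      ∃ᵈ (∃ᵈ (pair∈ᵈ (suc zero) zero (weakenᵈ (weakenᵈ d)) ×ᵈ
              ≤ᵈ (suc (suc i)) zero ×ᵈ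
              selectᵈ (suc (suc i) ∷ suc (suc j) ∷ suc zero ∷ []) equalᵈ))

    witnessed⇒∈ : ∀ {G q π} τ → GenericFilter G → q ∈ G → Witnessed q π τ → val G π ∈ val G τ
    witnessed⇒∈ {G} τ g q∈G (ρ , _ , s , _ , ρs∈τ , q≤s , _ , _ , f) =
      ∈-respˡ (val G τ) (≈-sym (f G g q∈G)) (val-∈ G τ (G-up g q∈G q≤s) ρs∈τ)

    -- The truth lemma for a single pair of names, isolated to serve as the induction hypothesis.
    EqualityTruth : V → V → Set₁
    EqualityTruth σ τ = ∀ G → GenericFilter G → val G σ ≈ val G τ →
      ∃[ p ] p ∈ G × Forces 𝕄 ℙ p [] v₀≐v₁ (σ ∷ τ ∷ [])

    opaque
      -- The value of `π` equals that of some `ρ` with `⟪ ρ , s ⟫ ∈ τ` and `s ∈ G`; extend `s` and a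
      -- condition forcing this equality. Asking for truth only at names below `τ` makes the lemma
      -- usable inside the induction on names.
      ∈⇒witnessed : ∀ {G π τ} → (∀ ρ → Name ρ → TransClosure _∈_ ρ τ → EqualityTruth π ρ) →
        Name π → NameClass τ → GenericFilter G → val G π ∈ val G τ →
        ∃[ q ] q ∈ G × Witnessed q π τ
      ∈⇒witnessed {G} {π} {τ} truth n nτ g π∈τ =
        let ρ , s , s∈G , ρs∈τ , e = val-∈⁻ G τ π∈τ
            nρ , s∈P = NameClass-elements τ nτ ρs∈τ
            p , p∈G , f = truth ρ nρ (∈-⟪,⟫⁺ s τ ρs∈τ) G g e
            q , q∈G , q≤p , q≤s = common₂ g p∈G s∈G
        in q , q∈G , ρ , proj₁ nρ , s , P⊆M s∈P , ρs∈τ , q≤s , G⇒P g q∈G , n ∷ nρ ∷ [] ,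
           λ G′ g′ q∈G′ → f G′ g′ (G-up g′ q∈G′ q≤p)

    generic-decides-∈ : ∀ {π τ G} → Name π → NameClass τ → GenericFilter G →
      (∃[ q ] q ∈ G × Witnessed q π τ) ⊎ (∃[ q ] q ∈ G × (∀ q′ → q′ ≤ q → ¬ Witnessed q′ π τ))
    generic-decides-∈ (π∈M , _) (τ∈𝒞 , _) =
      generic-decides (witnessedᵈ zero (suc zero) (constantᵈ τ∈𝒞)) (π∈M ∷ [])

    -- q decides σ ⊈ τ: some element π of σ is in σᴳ but never witnessed to be in τ.
    Separates : V → V → V → Set₁
    Separates q σ τ = ∃[ π ] π ∈ M × ∃[ r ] r ∈ M × ⟪ π , r ⟫ ∈ σ × q ≤ r ×
      (∀ q′ → q′ ∈ M → q′ ≤ q → ¬ Witnessed q′ π τ)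

    separatesᵈ : ∀ {σ τ} → NameClass σ → NameClass τ →
      Definable {1} (λ ρ → Separates (head ρ) σ τ)
    separatesᵈ (σ∈𝒞 , _) (τ∈𝒞 , _) = respᵈ
      (λ { (q ∷ []) _ → mk⇔ (λ h → h) (λ h → h) })
      (∃ᵈ (∃ᵈ (pair∈ᵈ (suc zero) zero (constantᵈ σ∈𝒞) ×ᵈ ≤ᵈ (suc (suc zero)) zero ×ᵈ
        ∀ᵈ (≤ᵈ zero (suc (suc (suc zero))) →ᵈ
            ¬ᵈ witnessedᵈ zero (suc (suc zero)) (constantᵈ τ∈𝒞)))))

    never-separated : ∀ {p σ τ} → NameClass σ → NameClass τ →
      (∀ q → q ≤ p → ¬ Separates q σ τ) →
      ∀ {G} → GenericFilter G → p ∈ G → ∀ {x} → x ∈ val G σ → x ∈ val G τ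
    never-separated {p} {σ} {τ} nσ nτ h {G} g p∈G x∈ =
      let π , r , r∈G , πr∈σ , e = val-∈⁻ G σ x∈
          nπ , r∈P = NameClass-elements σ nσ πr∈σ
      in ∈-respˡ (val G τ) (≈-sym e) (
        [ (λ (q , q∈G , w) → witnessed⇒∈ τ g q∈G w)
        , (λ (q , q∈G , ¬w) →
            -- Below `r` the value of `π` is in that of `σ`, and below `q` it is never witnessed in
            -- `τ`, so `s` would separate below `p`.
            let s , _ , s≤p , s≤q , s≤r = common₃ g p∈G q∈G r∈G
            in ⊥-elim (h s s≤p (π , proj₁ nπ , r , P⊆M r∈P , πr∈σ , s≤r ,
                 λ q′ _ q′≤s → ¬w q′ (≤-trans _ _ _ q′≤s s≤q))))
        ]′ (generic-decides-∈ nπ nτ g))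

    -- An inclusion would put the value of `π` into that of `τ`. The induction hypothesis then
    -- yields a witness in `G`, and a common extension with `q` is a witnessed condition below `q`.
    separated⇒⊈ : ∀ {G q σ τ} → NameClass σ → NameClass τ →
      (∀ π ρ → Name π → Name ρ → TransClosure _∈_ π σ → TransClosure _∈_ ρ τ →
        EqualityTruth π ρ) →
      GenericFilter G → q ∈ G → Separates q σ τ → ¬ (∀ {x} → x ∈ val G σ → x ∈ val G τ)
    separated⇒⊈ {G} {q} {σ} {τ} nσ nτ truth g q∈G (π , _ , r , _ , πr∈σ , q≤r , ¬w) σ⊆τ =
      let nπ , _ = NameClass-elements σ nσ πr∈σ
          π∈ = val-∈ G σ (G-up g q∈G q≤r) πr∈σ
          p , p∈G , ρ , ρ∈M , s , s∈M , ρs∈τ , p≤s , _ , ns , f =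
            ∈⇒witnessed (λ ρ nρ ρ∈⁺τ → truth π ρ nπ nρ (∈-⟪,⟫⁺ r σ πr∈σ) ρ∈⁺τ)
              nπ nτ g (σ⊆τ π∈)
          q′ , q′∈G , q′≤p , q′≤q = common₂ g p∈G q∈G
      in ¬w q′ (≤⇒∈M q′≤p) q′≤q
           (ρ , ρ∈M , s , s∈M , ρs∈τ , ≤-trans _ _ _ q′≤p p≤s , G⇒P g q′∈G , ns ,
            λ G′ g′ q′∈G′ → f G′ g′ (G-up g′ q′∈G′ q′≤p))

    opaque
      eventually-unseparated : ∀ {G σ τ} → NameClass σ → NameClass τ →
        (∀ π ρ → Name π → Name ρ → TransClosure _∈_ π σ → TransClosure _∈_ ρ τ →
          EqualityTruth π ρ) →
        GenericFilter G → (∀ {x} → x ∈ val G σ → x ∈ val G τ) →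
        ∃[ p ] p ∈ G × (∀ q → q ≤ p → ¬ Separates q σ τ)
      eventually-unseparated nσ nτ truth g σ⊆τ =
        [ (λ (_ , q∈G , s) → ⊥-elim (separated⇒⊈ nσ nτ truth g q∈G s σ⊆τ))
        , (λ h → h)
        ]′ (generic-decides (separatesᵈ nσ nτ) [] g)

    EqualityTruth-sym : ∀ {σ τ} → EqualityTruth σ τ → EqualityTruth τ σ
    EqualityTruth-sym truth G g e =
      let p , p∈G , f = truth G g (≈-sym e) in p , p∈G , λ G′ g′ p∈G′ → ≈-sym (f G′ g′ p∈G′)

    opaque
      -- Induction on `σ` alone, for all `τ`: either inclusion appeals only to pairs with one
      -- component below `σ`.
      equality-truth : ∀ σ τ → Name σ → Name τ → EqualityTruth σ τ
      equality-truth = WF.All.wfRec (TC.wellFounded _∈_ ∈-wellFounded) _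
        (λ σ → ∀ τ → Name σ → Name τ → EqualityTruth σ τ)
        λ σ ih τ nσ nτ G g e →
          let cσ = Name⇒NameClass nσ
              cτ = Name⇒NameClass nτ
              p , p∈G , σ⊆τ = eventually-unseparated cσ cτ
                (λ π ρ nπ nρ π∈⁺σ _ → ih π∈⁺σ ρ nπ nρ) g (∈-respʳ e)
              -- Here the component below `σ` comes second, so the induction hypothesis is used
              -- through symmetry.
              q , q∈G , τ⊆σ = eventually-unseparated cτ cσ
                (λ π ρ nπ nρ _ ρ∈⁺σ → EqualityTruth-sym (ih ρ∈⁺σ π nρ nπ)) g (∈-respʳ (≈-sym e))
              r , r∈G , r≤p , r≤q = common₂ g p∈G q∈G
          in r , r∈G , λ G′ g′ r∈G′ → ≈-ext λ z → mk⇔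
               (never-separated cσ cτ σ⊆τ g′ (G-up g′ r∈G′ r≤p))
               (never-separated cτ cσ τ⊆σ g′ (G-up g′ r∈G′ r≤q))

    membership-truth : ∀ {G σ Γ} → Name σ → NameClass Γ → GenericFilter G →
      val G σ ∈ val G Γ → ∃[ q ] q ∈ G × Witnessed q σ Γ
    membership-truth n = ∈⇒witnessed (λ ρ nρ _ → equality-truth _ ρ n nρ) n

    -- Forced membership in set names and class names.

    DenselyWitnessed : V → V → V → Set₁
    DenselyWitnessed p σ Γ =
      ∀ q → q ∈ M → q ≤ p → ∃[ q′ ] q′ ∈ M × q′ ≤ q × Witnessed q′ σ Γ

    denselyWitnessedᵈ : ∀ {m} {F : Vec V m → V} (i j : Fin m) → DefinableElements F →
      Definable (λ ρ → DenselyWitnessed (lookup ρ i) (lookup ρ j) (F ρ))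
    denselyWitnessedᵈ i j d =
      ∀ᵈ (≤ᵈ zero (suc i) →ᵈ ∃ᵈ (≤ᵈ zero (suc zero) ×ᵈ
        witnessedᵈ zero (suc (suc j)) (weakenᵈ (weakenᵈ d))))

    denselyWitnessed⇒forced : ∀ {p σ Γ} → Name σ → NameClass Γ → DenselyWitnessed p σ Γ →
      ∀ G → GenericFilter G → p ∈ G → val G σ ∈ val G Γ
    denselyWitnessed⇒forced {p} {σ} {Γ} nσ nΓ h G g p∈G =
      [ (λ (q , q∈G , w) → witnessed⇒∈ Γ g q∈G w)
      , (λ (q , q∈G , ¬w) →
          let r , _ , r≤p , r≤q = common₂ g p∈G q∈G
              s , _ , s≤r , w = h r (≤⇒∈M r≤p) r≤p
          in ⊥-elim (¬w s (≤-trans _ _ _ s≤r r≤q) w))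
      ]′ (generic-decides-∈ nσ nΓ g)

    -- In a generic filter through `q` the membership holds and is witnessed by some `r`; a common
    -- extension of `q` and `r` is the required condition.
    forced⇒denselyWitnessed : ∀ {p σ Γ} → Name σ → NameClass Γ →
      (∀ G → GenericFilter G → p ∈ G → val G σ ∈ val G Γ) → DenselyWitnessed p σ Γ
    forced⇒denselyWitnessed nσ nΓ f q _ q≤p =
      let G , g , q∈G = generic-exists (proj₁ (≤⇒∈P q≤p))
          r , r∈G , ρ , ρ∈M , s , s∈M , ρs∈Γ , r≤s , _ , ns , f′ =
            membership-truth nσ nΓ g (f G g (G-up g q∈G q≤p))
          q′ , q′∈G , q′≤q , q′≤r = common₂ g q∈G r∈G
      in q′ , ≤⇒∈M q′≤q , q′≤q , ρ , ρ∈M , s , s∈M , ρs∈Γ , ≤-trans _ _ _ q′≤r r≤s ,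
         G⇒P g q′∈G , ns , λ G′ g′ q′∈G′ → f′ G′ g′ (G-up g′ q′∈G′ q′≤r)

    -- Induction on formulas.

    conditionᵈ : ∀ m → Definable {suc m} (λ ρ → head ρ ∈ P × All Name (tail ρ))
    conditionᵈ zero = respᵈ
      (λ { (p ∷ []) _ → mk⇔ (λ p∈P → p∈P , []) proj₁ })
      (∈classᵈ P∈𝒞 zero)
    conditionᵈ (suc m) = respᵈ
      (λ { (p ∷ σ ∷ σs) _ → mk⇔
        (λ ((p∈P , n) , (_ , ns)) → p∈P , n ∷ ns)
        (λ { (p∈P , n ∷ ns) → (p∈P , n) , (p∈P , ns) }) })
      (selectᵈ (zero ∷ suc zero ∷ []) nameᵈ ×ᵈ dropSecondᵈ (conditionᵈ m))

    -- The two halves are proved together because at a negation each depends on the other: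
    -- definability uses truth of the subformula, and truth uses its definability.
    record Forceable {n m} (Γ : Vec V n) (φ : Formula n m) : Set₁ where
      field
        forcedᵈ : Definable (Forced Γ φ)
        truth   : ∀ σ → All Name σ → ∀ G → GenericFilter G → HoldsIn 𝕄 ℙ G Γ φ σ →
                  ∃[ p ] p ∈ G × Forces 𝕄 ℙ p Γ φ σ

    open Forceable

    module _ {n} (Γ : Vec V n) (nΓ : All NameClass Γ) where

      -- Letting `F` be a variable or a fixed class treats the atoms `i ∈̇ j` and `A k i` at once.
      forceable-membership : ∀ {m} (φ : Formula n m) (i : Fin m) {F : Vec V m → V} →
        DefinableElements F → (∀ σ → All Name σ → NameClass (F σ)) →
        (∀ G σ → HoldsIn 𝕄 ℙ G Γ φ σ ⇔ val G (lookup σ i) ∈ val G (F σ)) →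
        Forceable Γ φ
      forceable-membership φ i {F} d nF holds .forcedᵈ = respᵈ
        (λ { (p ∷ σ) _ → mk⇔
          (λ ((p∈P , ns) , w) → p∈P , ns , λ G g p∈G → from (holds G σ)
            (denselyWitnessed⇒forced (lookup⁺ ns i) (nF σ ns) w G g p∈G))
          (λ (p∈P , ns , f) → (p∈P , ns) ,
            forced⇒denselyWitnessed (lookup⁺ ns i) (nF σ ns)
              λ G g p∈G → to (holds G σ) (f G g p∈G)) })
        (conditionᵈ _ ×ᵈ denselyWitnessedᵈ zero (suc i) (weakenᵈ d))
      forceable-membership φ i {F} d nF holds .truth σ ns G g h =
        let q , q∈G , w = membership-truth (lookup⁺ ns i) (nF σ ns) g (to (holds G σ) h)
        in q , q∈G , λ G′ g′ q∈G′ → from (holds G′ σ) (witnessed⇒∈ (F σ) g′ q∈G′ w)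

      holds-∈̇ : ∀ G {m} (i j : Fin m) σ →
        HoldsIn 𝕄 ℙ G Γ (i ∈̇ j) σ ⇔ val G (lookup σ i) ∈ val G (lookup σ j)
      holds-∈̇ G i j σ rewrite lookup-map i (val G) σ | lookup-map j (val G) σ =
        mk⇔ (λ h → h) (λ h → h)

      holds-≐ : ∀ G {m} (i j : Fin m) σ →
        HoldsIn 𝕄 ℙ G Γ (i ≐ j) σ ⇔ val G (lookup σ i) ≈ val G (lookup σ j)
      holds-≐ G i j σ rewrite lookup-map i (val G) σ | lookup-map j (val G) σ =
        mk⇔ (λ h → h) (λ h → h)

      holds-A : ∀ G {m} k (i : Fin m) σ →
        HoldsIn 𝕄 ℙ G Γ (A k i) σ ⇔ val G (lookup σ i) ∈ val G (lookup Γ k)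
      holds-A G k i σ rewrite lookup-map i (val G) σ | lookup-map k (val G) Γ =
        mk⇔ (λ h → h) (λ h → h)

      forceable-equality : ∀ {m} (i j : Fin m) → Forceable Γ (i ≐ j)
      forceable-equality i j .forcedᵈ = respᵈ
        (λ { (p ∷ σ) _ → mk⇔
          (λ ((p∈P , ns) , _ , _ , f) → p∈P , ns , λ G g p∈G → from (holds-≐ G i j σ) (f G g p∈G))
          (λ (p∈P , ns , f) → (p∈P , ns) , p∈P , lookup⁺ ns i ∷ lookup⁺ ns j ∷ [] ,
            λ G g p∈G → to (holds-≐ G i j σ) (f G g p∈G)) })
        (conditionᵈ _ ×ᵈ selectᵈ (zero ∷ suc i ∷ suc j ∷ []) equalᵈ)
      forceable-equality i j .truth σ ns G g h =
        let p , p∈G , f = equality-truth _ _ (lookup⁺ ns i) (lookup⁺ ns j) G g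
                            (to (holds-≐ G i j σ) h)
        in p , p∈G , λ G′ g′ p∈G′ → from (holds-≐ G′ i j σ) (f G′ g′ p∈G′)

      -- If `φ` held, some condition in `G` would force it, and so would its common extension with
      -- `p`.
      never-forced : ∀ {m p} {φ : Formula n m} → Forceable Γ φ → ∀ σ → All Name σ →
        (∀ q → q ≤ p → ¬ Forced Γ φ (q ∷ σ)) → Forces 𝕄 ℙ p Γ (¬̇ φ) σ
      never-forced {φ = φ} F σ ns ¬f G g p∈G h =
        let q , q∈G , f = F .truth σ ns G g h
            r , r∈G , r≤p , r≤q = common₂ g p∈G q∈G
        in ¬f r r≤p (G⇒P g r∈G , ns , Forces-≤ {φ = φ} r≤q f)

      forceable-¬ : ∀ {m} {φ : Formula n m} → Forceable Γ φ → Forceable Γ (¬̇ φ)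
      forceable-¬ F .forcedᵈ = respᵈ
        (λ { (p ∷ σ) _ → mk⇔
          (λ ((p∈P , ns) , ¬f) → p∈P , ns ,
            never-forced F σ ns (λ q q≤p → ¬f q (≤⇒∈M q≤p) q≤p))
          (λ (p∈P , ns , f) → (p∈P , ns) , λ q _ q≤p (q∈P , _ , f′) →
            -- The extension by a generic filter through `q` would satisfy both `φ` and its
            -- negation.
            let G , g , q∈G = generic-exists q∈P
            in f G g (G-up g q∈G q≤p) (f′ G g q∈G)) })
        (conditionᵈ _ ×ᵈ ∀ᵈ (≤ᵈ zero (suc zero) →ᵈ ¬ᵈ dropSecondᵈ (F .forcedᵈ)))
      forceable-¬ F .truth σ ns G g ¬h =
        [ (λ (p , p∈G , _ , _ , f) → ⊥-elim (¬h (f G g p∈G)))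
        , (λ (p , p∈G , ¬f) → p , p∈G , never-forced F σ ns ¬f)
        ]′ (generic-decides (F .forcedᵈ) (All.map proj₁ ns) g)

      forceable-∧ : ∀ {m} {φ ψ : Formula n m} →
        Forceable Γ φ → Forceable Γ ψ → Forceable Γ (φ ∧̇ ψ)
      forceable-∧ {φ = φ} {ψ} F H .forcedᵈ = respᵈ {R = λ ρ → Forced Γ φ ρ × Forced Γ ψ ρ}
        (λ ρ _ → mk⇔
          (λ ((p∈P , ns , f) , (_ , _ , f′)) → p∈P , ns , λ G g p∈G → f G g p∈G , f′ G g p∈G)
          (λ (p∈P , ns , f) → (p∈P , ns , λ G g p∈G → proj₁ (f G g p∈G)) ,
                              (p∈P , ns , λ G g p∈G → proj₂ (f G g p∈G))))
        (F .forcedᵈ ×ᵈ H .forcedᵈ)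
      forceable-∧ F H .truth σ ns G g (h , h′) =
        let p , p∈G , f  = F .truth σ ns G g h
            q , q∈G , f′ = H .truth σ ns G g h′
            r , r∈G , r≤p , r≤q = common₂ g p∈G q∈G
        in r , r∈G , λ G′ g′ r∈G′ →
             f G′ g′ (G-up g′ r∈G′ r≤p) , f′ G′ g′ (G-up g′ r∈G′ r≤q)

      -- For truth, `G` decides the class of conditions forcing `¬̇ φ` at some name. A member of
      -- this class in `G` would refute the assumption; a condition with no extension in the class
      -- forces every instance.
      forceable-∀ : ∀ {m} {φ : Formula n (suc m)} → Forceable Γ φ → Forceable Γ (∀̇ φ)
      forceable-∀ {φ = φ} F .forcedᵈ = respᵈ
        {R = λ ρ → (head ρ ∈ P × All Name (tail ρ)) ×
          (∀ τ → τ ∈ M → lookup ρ zero ∈ P × Name τ → Forced Γ φ (head ρ ∷ τ ∷ tail ρ))}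
        (λ { (p ∷ σ) _ → mk⇔
          (λ ((p∈P , ns) , h) → p∈P , ns , λ G g p∈G (i , n) →
            let τ∈M = i , ≈-refl
                _ , _ , f = h (elem M i) τ∈M (p∈P , τ∈M , n)
            in f G g p∈G)
          -- The extension is indexed by the names among the sets `elem M i`; an arbitrary name `τ`
          -- equals one of them only up to `≈`.
          (λ (p∈P , ns , f) → (p∈P , ns) , λ { τ _ (_ , n@((i , e) , n′)) →
            p∈P , n ∷ ns , λ G g p∈G → ⊨-cong φ
              (≈-sym (val-cong G e) ∷ Pointwise.refl ≈-refl)
              (f G g p∈G (i , IsName-cong P e n′)) }) })
        (conditionᵈ _ ×ᵈ ∀ᵈ (selectᵈ (suc zero ∷ zero ∷ []) nameᵈ →ᵈ swapᵈ (F .forcedᵈ)))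
      forceable-∀ {φ = φ} F .truth σ ns G g h =
        [ (λ { (p , p∈G , τ , _ , _ , ((i , e) , n) ∷ _ , f) → ⊥-elim (f G g p∈G
            (⊨-cong φ (≈-sym (val-cong G e) ∷ Pointwise.refl ≈-refl)
              (h (i , IsName-cong P e n)))) })
        , (λ (p , p∈G , ¬f) → p , p∈G , λ G′ g′ p∈G′ (i , n) →
            -- If an instance failed in the extension by `G′`, the truth lemma for `¬̇ φ` would give
            -- a condition forcing its negation, and this could be extended below `p`.
            decidable-stable (map′ lower lift em₁) λ ¬h →
              let nτ = (i , ≈-refl) , n
                  q , q∈G′ , f = ¬F .truth (elem M i ∷ σ) (nτ ∷ ns) G′ g′ ¬h
                  r , r∈G′ , r≤p , r≤q = common₂ g′ p∈G′ q∈G′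
              in ¬f r r≤p (elem M i , (i , ≈-refl) , G⇒P g′ r∈G′ , nτ ∷ ns ,
                   Forces-≤ {φ = ¬̇ φ} r≤q f))
        ]′ (generic-decides (∃ᵈ (swapᵈ (¬F .forcedᵈ))) (All.map proj₁ ns) g)
        where
        ¬F : Forceable Γ (¬̇ φ)
        ¬F = forceable-¬ F

      forceable : ∀ {m} (φ : Formula n m) → Forceable Γ φ
      forceable (i ∈̇ j) = forceable-membership (i ∈̇ j) i (variableᵈ j)
        (λ σ ns → Name⇒NameClass (lookup⁺ ns j)) (λ G → holds-∈̇ G i j)
      forceable (i ≐ j) = forceable-equality i j
      forceable (A k i) = forceable-membership (A k i) i (constantᵈ (proj₁ (lookup⁺ nΓ k)))
        (λ σ ns → lookup⁺ nΓ k) (λ G → holds-A G k i)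
      forceable (¬̇ φ)   = forceable-¬ (forceable φ)
      forceable (φ ∧̇ ψ) = forceable-∧ (forceable φ) (forceable ψ)
      forceable (∀̇ φ)   = forceable-∀ (forceable φ)

    forcing-theorem : ∀ {n m} (φ : Formula n m) → ForcingTheorem 𝕄 ℙ φ
    forcing-theorem {m = m} φ .proj₁ Γ nΓ =
      let D , D∈𝒞 , h = comprehension (tuplesᵈ m (forceable Γ nΓ φ .forcedᵈ)) []
      in D , D∈𝒞 , λ x → mk⇔
        (λ x∈D → let _ , p , σ , _ , r = to (h x) x∈D in p , σ , r)
        (λ (p , σ , e , p∈P , ns , f) →
          let p∈M = P⊆M p∈P ; σ∈M = All.map proj₁ ns
          in from (h x) (∈-respˡ M (≈-sym e) (tuple∈M σ p∈M σ∈M) ,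
               p , σ , p∈M ∷ σ∈M , e , p∈P , ns , f))
    forcing-theorem φ .proj₂ σ ns Γ nΓ = forceable Γ nΓ φ .truth σ ns

theorem4p3 : ExcludedMiddle (lsuc 0ℓ) →
    (𝕄 : CountableTransitiveModel) (ℙ : ClassForcing 𝕄) →
    DefinabilityLemma 𝕄 ℙ v₀∈v₁ ⊎ DefinabilityLemma 𝕄 ℙ v₀≐v₁ →
    (n m : ℕ) (φ : Formula n m) → ForcingTheorem 𝕄 ℙ φ
theorem4p3 em 𝕄 ℙ hypothesis n m = FromEquality.forcing-theorem (equalᵈ hypothesis)
  where
  open Forcing em 𝕄 ℙ
  equalᵈ : DefinabilityLemma 𝕄 ℙ v₀∈v₁ ⊎ DefinabilityLemma 𝕄 ℙ v₀≐v₁ →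
    Definability.Definable _ 𝕄 (Forced [] v₀≐v₁)
  equalᵈ (inj₁ h) = FromMembership.equalᵈ (DefinabilityLemma⇒Forcedᵈ v₀∈v₁ h)
  equalᵈ (inj₂ h) = DefinabilityLemma⇒Forcedᵈ v₀≐v₁ h
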